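{- For a prime $p$ and $n\in\mathbb{N}$, let $C_{n,p}$ denote the size of the largest affine cap in $\mathbb{Z}_p^n$, and let $c_p=\lim_{n\to\infty}(C_{n,p})^{1/n}$. Then $$C_{n,11}\gg \frac{5^{n}}{n^{1.5}},\quad C_{n,17}\gg \frac{7^{n}}{n^{2.5}},\quad C_{n,23}\gg \frac{9^{n}}{n^{3.5}},\quad C_{n,29}\gg \frac{10^{n}}{n^{4}}\quad\text{and}\quad C_{n,41}\gg \frac{12^{n}}{n^{5}}.$$ As a consequence, $$c_{11}\geq 5,\quad c_{17}\geq 7,\quad c_{23}\geq 9,\quad c_{29}\geq 10\quad\text{and}\quad c_{41}\geq 12.$$
   Context: For a prime $p$, $\mathbb{Z}_p=\mathbb{Z}/p\mathbb{Z}$ is the field with $p$ elements, and $\mathrm{AG}(n,p)=\mathbb{Z}_p^n$ is the $n$-dimensional affine space over it. An affine cap is a subset $S\subseteq\mathbb{Z}_p^n$ such that no three points of $S$ are collinear, i.e., for any three pairwise distinct points $x,y,z\in S$ the vectors $y-x$ and $z-x$ are linearly independent over $\mathbb{Z}_p$. (Equivalently: for any pairwise distinct $x,y,z\in S$ and any $(a,b,c)\in\mathbb{Z}_p^3\setminus\{(0,0,0)\}$ with $a+b+c=0$ one has $ax+by+cz\neq 0$.) Vinogradov notation: $f(n)\gg g(n)$ means that there exist $C>0$ and $n_0$ such that $f(n)\geq C\,g(n)$ for all $n>n_0$. It is known that the limit $c_p=\lim_{n\to\infty}(C_{n,p})^{1/n}$ exists. -}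

module Defs where

open import Data.Nat as ℕ using (ℕ; zero; suc; NonZero; _^_; _≤?_)
import Data.Nat.Properties as ℕ
open import Data.Nat.DivMod using (_mod_)
open import Data.Integer as ℤ using (+_)
import Data.Integer.Properties as ℤ
open import Data.Rational as ℚ using (ℚ; 0ℚ; 1ℚ; ½)
import Data.Rational.Properties as ℚ
import Data.Rational.Unnormalised as ℚᵘ
import Data.Rational.Unnormalised.Properties as ℚᵘ
open import Data.Rational.Solver using (module +-*-Solver)
open import Data.Fin using (Fin; toℕ; finToFun)
open import Data.Fin.Properties using (all?) renaming (_≟_ to _≟ᶠ_)
open import Data.Fin.Subset using (Subset; _∈_; ∣_∣; ⊥)
open import Data.Fin.Subset.Properties using (anySubset?; ∣p∣≤n; ∣⊥∣≡0; ∉⊥; _∈?_)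
open import Data.Product using (∃-syntax; _×_; _,_; proj₁; proj₂)
open import Data.Sum using (inj₁; inj₂)
open import Data.Empty using (⊥-elim)
open import Algebra.Bundles using (CommutativeMonoid)
open import Level using (0ℓ)
open import Relation.Nullary using (Dec; yes; no; ¬?)
open import Relation.Nullary.Decidable using (_×-dec_; _→-dec_)
open import Relation.Unary using (Pred; Decidable)
open import Relation.Binary.PropositionalEquality
  using (_≡_; _≢_; refl; sym; trans; cong; cong₂; subst; subst₂)

greatest : {P : Pred ℕ 0ℓ} → Decidable P → ℕ → ℕ
greatest P? zero = zero
greatest P? (suc b) with P? (suc b)
... | yes _ = suc b
... | no  _ = greatest P? b

greatest-holds : {P : Pred ℕ 0ℓ} (P? : Decidable P) → P 0 → ∀ b → P (greatest P? b)
greatest-holds P? P0 zero = P0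
greatest-holds P? P0 (suc b) with P? (suc b)
... | yes p = p
... | no  _ = greatest-holds P? P0 b

greatest-max : {P : Pred ℕ 0ℓ} (P? : Decidable P) → ∀ b {m} → m ℕ.≤ b → P m →
               m ℕ.≤ greatest P? b
greatest-max P? zero m≤b _ = m≤b
greatest-max P? (suc b) {m} m≤b Pm with P? (suc b)
... | yes _ = m≤b
... | no ¬p with ℕ.m≤n⇒m<n∨m≡n m≤b
...   | inj₁ m<1+b = greatest-max P? b (ℕ.s≤s⁻¹ m<1+b) Pm
...   | inj₂ refl  = ⊥-elim (¬p Pm)

-- ℤ/pℤ on the representatives 0, …, p − 1.
module Residues (p : ℕ) .{{_ : NonZero p}} where

  infixl 7 _*ₚ_
  infixl 6 _+ₚ_ _-ₚ_

  0ₚ : Fin p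
  0ₚ = 0 mod p

  _+ₚ_ _-ₚ_ _*ₚ_ : Fin p → Fin p → Fin p
  x +ₚ y = (toℕ x ℕ.+ toℕ y) mod p
  x -ₚ y = (toℕ x ℕ.+ (p ℕ.∸ toℕ y)) mod p
  x *ₚ y = (toℕ x ℕ.* toℕ y) mod p

module _ (n p : ℕ) .{{_ : NonZero p}} where

  open Residues p

  LinearlyIndependent : (u v : Fin n → Fin p) → Set
  LinearlyIndependent u v =
    ∀ a b → (∀ i → a *ₚ u i +ₚ b *ₚ v i ≡ 0ₚ) → a ≡ 0ₚ × b ≡ 0ₚ

  -- The points of AG(n,p) are numbered through the bijection
  -- finToFun : Fin (p ^ n) → (Fin n → Fin p), so that finite sets of points
  -- are the library's subsets of Fin (p ^ n).
  point : Fin (p ^ n) → Fin n → Fin p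
  point = finToFun

  _⟶⟨_⟩ : Fin (p ^ n) → Fin (p ^ n) → Fin n → Fin p
  (x ⟶⟨ y ⟩) i = point y i -ₚ point x i

  IsCap : Subset (p ^ n) → Set
  IsCap S = ∀ x y z → x ∈ S → y ∈ S → z ∈ S → x ≢ y → x ≢ z → y ≢ z →
            LinearlyIndependent (x ⟶⟨ y ⟩) (x ⟶⟨ z ⟩)

  HasCapOfSize : ℕ → Set
  HasCapOfSize k = ∃[ S ] IsCap S × ∣ S ∣ ≡ k

  linearlyIndependent? : ∀ u v → Dec (LinearlyIndependent u v)
  linearlyIndependent? u v = all? λ a → all? λ b →
    all? (λ i → a *ₚ u i +ₚ b *ₚ v i ≟ᶠ 0ₚ) →-dec (a ≟ᶠ 0ₚ ×-dec b ≟ᶠ 0ₚ)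

  isCap? : Decidable IsCap
  isCap? S = all? λ x → all? λ y → all? λ z →
    (x ∈? S) →-dec (y ∈? S) →-dec (z ∈? S) →-dec
    ¬? (x ≟ᶠ y) →-dec ¬? (x ≟ᶠ z) →-dec ¬? (y ≟ᶠ z) →-dec
    linearlyIndependent? (x ⟶⟨ y ⟩) (x ⟶⟨ z ⟩)

  hasCapOfSize? : Decidable HasCapOfSize
  hasCapOfSize? k = anySubset? λ S → isCap? S ×-dec (∣ S ∣ ℕ.≟ k)

  maxCapSize : ℕ
  maxCapSize = greatest hasCapOfSize? (p ^ n)

  maxCapSize-attained : HasCapOfSize maxCapSize
  maxCapSize-attained = greatest-holds hasCapOfSize? emptyCap (p ^ n)
    where
    emptyCap : HasCapOfSize 0
    emptyCap = ⊥ , (λ _ _ _ x∈⊥ → ⊥-elim (∉⊥ x∈⊥)) , ∣⊥∣≡0 (p ^ n)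

  maxCapSize-max : ∀ S → IsCap S → ∣ S ∣ ℕ.≤ maxCapSize
  maxCapSize-max S cap =
    greatest-max hasCapOfSize? (p ^ n) (∣p∣≤n S) (S , cap , refl)

private

  ∣p∣≤-intro : ∀ {p ε} → p ℚ.≤ ε → ℚ.- p ℚ.≤ ε → ℚ.∣ p ∣ ℚ.≤ ε
  ∣p∣≤-intro {p} p≤ε -p≤ε with ℚ.∣p∣≡p∨∣p∣≡-p p
  ... | inj₁ eq = subst (ℚ._≤ _) (sym eq) p≤ε
  ... | inj₂ eq = subst (ℚ._≤ _) (sym eq) -p≤ε

  neg-sub : ∀ p q → ℚ.- (p ℚ.- q) ≡ q ℚ.- p
  neg-sub = solve 2 (λ p q → :- (p :- q) := q :- p) refl
    where open +-*-Solver

  ∣-∣-sym : ∀ p q → ℚ.∣ p ℚ.- q ∣ ≡ ℚ.∣ q ℚ.- p ∣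
  ∣-∣-sym p q = trans (sym (ℚ.∣-p∣≡∣p∣ (p ℚ.- q))) (cong ℚ.∣_∣ (neg-sub p q))

  ≤-sub : ∀ {p q ε} → p ℚ.≤ q ℚ.+ ε → p ℚ.- q ℚ.≤ ε
  ≤-sub {p} {q} {ε} le =
    subst (p ℚ.- q ℚ.≤_) (cancel q ε) (ℚ.+-monoˡ-≤ (ℚ.- q) le)
    where
    open +-*-Solver
    cancel : ∀ q ε → q ℚ.+ ε ℚ.- q ≡ ε
    cancel = solve 2 (λ q ε → q :+ ε :- q := ε) refl

  ∣p∣≤∣q∣+∣p-q∣ : ∀ p q → ℚ.∣ p ∣ ℚ.≤ ℚ.∣ q ∣ ℚ.+ ℚ.∣ p ℚ.- q ∣
  ∣p∣≤∣q∣+∣p-q∣ p q =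
    subst (λ r → ℚ.∣ r ∣ ℚ.≤ ℚ.∣ q ∣ ℚ.+ ℚ.∣ p ℚ.- q ∣) (add p q)
      (ℚ.∣p+q∣≤∣p∣+∣q∣ q (p ℚ.- q))
    where
    open +-*-Solver
    add : ∀ p q → q ℚ.+ (p ℚ.- q) ≡ p
    add = solve 2 (λ p q → q :+ (p :- q) := p) refl

  ∣∣p∣-∣q∣∣≤∣p-q∣ : ∀ p q → ℚ.∣ ℚ.∣ p ∣ ℚ.- ℚ.∣ q ∣ ∣ ℚ.≤ ℚ.∣ p ℚ.- q ∣
  ∣∣p∣-∣q∣∣≤∣p-q∣ p q = ∣p∣≤-intro
    (≤-sub (∣p∣≤∣q∣+∣p-q∣ p q))
    (subst₂ ℚ._≤_ (sym (neg-sub ℚ.∣ p ∣ ℚ.∣ q ∣)) (∣-∣-sym q p)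
      (≤-sub (∣p∣≤∣q∣+∣p-q∣ q p)))

  *-mono-≤ : ∀ {p q r s} → 0ℚ ℚ.≤ p → 0ℚ ℚ.≤ s → p ℚ.≤ q → r ℚ.≤ s →
             p ℚ.* r ℚ.≤ q ℚ.* s
  *-mono-≤ {p} {q} {r} {s} 0≤p 0≤s p≤q r≤s = ℚ.≤-trans
    (ℚ.*-monoˡ-≤-nonNeg p {{ℚ.nonNegative 0≤p}} r≤s)
    (ℚ.*-monoʳ-≤-nonNeg s {{ℚ.nonNegative 0≤s}} p≤q)

  *-pos : ∀ {p q} → 0ℚ ℚ.< p → 0ℚ ℚ.< q → 0ℚ ℚ.< p ℚ.* q
  *-pos {p} {q} 0<p 0<q =
    subst (ℚ._< p ℚ.* q) (ℚ.*-zeroˡ q) (ℚ.*-monoˡ-<-pos q {{ℚ.positive 0<q}} 0<p)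

  half-pos : ∀ {ε} → 0ℚ ℚ.< ε → 0ℚ ℚ.< ½ ℚ.* ε
  half-pos = *-pos (ℚ.positive⁻¹ ½)

  halves : ∀ ε → ½ ℚ.* ε ℚ.+ ½ ℚ.* ε ≡ ε
  halves ε = trans (sym (ℚ.*-distribʳ-+ ε ½ ½)) (ℚ.*-identityˡ ε)

recip : ℚ → ℚ
recip p with p ℚ.≟ 0ℚ
... | yes _  = 0ℚ
... | no p≢0 = (ℚ.1/ p) {{ℚ.≢-nonZero p≢0}}

recip-inverse : ∀ {p} → p ≢ 0ℚ → recip p ℚ.* p ≡ 1ℚ
recip-inverse {p} p≢0 with p ℚ.≟ 0ℚ
... | yes p≡0 = ⊥-elim (p≢0 p≡0)
... | no  q≢0 = ℚ.*-inverseˡ p {{ℚ.≢-nonZero q≢0}}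

recip-pos : ∀ {p} → 0ℚ ℚ.< p → 0ℚ ℚ.< recip p
recip-pos {p} 0<p with p ℚ.≟ 0ℚ
... | yes refl = ⊥-elim (ℚ.<-irrefl refl 0<p)
... | no  p≢0  = ℚ.positive⁻¹ _ {{ℚ.1/pos⇒pos p {{ℚ.positive 0<p}}}}

private

  >⇒≢ : ∀ {p} → 0ℚ ℚ.< p → p ≢ 0ℚ
  >⇒≢ 0<p refl = ℚ.<-irrefl refl 0<p

  /-mono : ∀ m k m′ k′ → m ℕ.* suc k′ ℕ.≤ m′ ℕ.* suc k →
           (+ m) ℚ./ suc k ℚ.≤ (+ m′) ℚ./ suc k′
  /-mono m k m′ k′ le = ℚ.toℚᵘ-cancel-≤
    (ℚᵘ.≤-respˡ-≃ (ℚᵘ.≃-sym (ℚ.toℚᵘ-fromℚᵘ (ℚᵘ.mkℚᵘ (+ m) k)))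
    (ℚᵘ.≤-respʳ-≃ (ℚᵘ.≃-sym (ℚ.toℚᵘ-fromℚᵘ (ℚᵘ.mkℚᵘ (+ m′) k′)))
    (ℚᵘ.*≤* (subst₂ ℤ._≤_ (ℤ.pos-* m (suc k′)) (ℤ.pos-* m′ (suc k)) (ℤ.+≤+ le)))))

  1/-≤ : ∀ ε → 0ℚ ℚ.< ε → ∀ k → ℚ.denominatorℕ ε ℕ.≤ suc k →
         (+ 1) ℚ./ suc k ℚ.≤ ε
  1/-≤ ε 0<ε k d≤k with ℚ.positive 0<ε
  1/-≤ (ℚ.mkℚ (+ suc n) d c) _ k d≤k | _ =
    subst ((+ 1) ℚ./ suc k ℚ.≤_) (ℚ.fromℚᵘ-toℚᵘ (ℚ.mkℚ (+ suc n) d c))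
      (/-mono 1 k (suc n) d
        (subst (ℕ._≤ suc n ℕ.* suc k) (sym (ℕ.*-identityˡ (suc d)))
          (ℕ.≤-trans d≤k (ℕ.m≤n*m (suc k) (suc n)))))

  /-suc : ∀ m k → (+ suc m) ℚ./ suc k ≡ (+ m) ℚ./ suc k ℚ.+ (+ 1) ℚ./ suc k
  /-suc m k = ℚ.toℚᵘ-injective
    (ℚᵘ.≃-trans (ℚ.toℚᵘ-fromℚᵘ (ℚᵘ.mkℚᵘ (+ suc m) k))
    (ℚᵘ.≃-trans split
    (ℚᵘ.≃-sym (ℚᵘ.≃-trans
      (ℚ.toℚᵘ-homo-+ ((+ m) ℚ./ suc k) ((+ 1) ℚ./ suc k))
      (ℚᵘ.+-cong (ℚ.toℚᵘ-fromℚᵘ (ℚᵘ.mkℚᵘ (+ m) k))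
                 (ℚ.toℚᵘ-fromℚᵘ (ℚᵘ.mkℚᵘ (+ 1) k)))))))
    where
    open import Data.Integer.Solver renaming (module +-*-Solver to ℤ-Solver)
    open ℤ-Solver
    split : ℚᵘ.mkℚᵘ (+ suc m) k ℚᵘ.≃ ℚᵘ.mkℚᵘ (+ m) k ℚᵘ.+ ℚᵘ.mkℚᵘ (+ 1) k
    split = ℚᵘ.*≡* (trans
      (cong₂ ℤ._*_ (ℤ.pos-+ 1 m) (ℤ.pos-* (suc k) (suc k)))
      (solve 2 (λ x d → (con (+ 1) :+ x) :* (d :* d)
                          := (x :* d :+ con (+ 1) :* d) :* d)
        refl (+ m) (+ suc k)))

-- Cauchy sequences of rationals. Two sequences are the same real when their
-- difference tends to 0, that is, when each is ≤ᵣ the other.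
record ℝ : Set where
  field
    seq    : ℕ → ℚ
    cauchy : ∀ ε → 0ℚ ℚ.< ε → ∃[ N ] ∀ m n → N ℕ.≤ m → N ℕ.≤ n →
             ℚ.∣ seq m ℚ.- seq n ∣ ℚ.≤ ε

open ℝ public

infix  4 _≤ᵣ_ _<ᵣ_
infixl 6 _-ᵣ_
infixl 7 _*ᵣ_ _/ᵣ_⟨_⟩

_≤ᵣ_ : ℝ → ℝ → Set
x ≤ᵣ y = ∀ ε → 0ℚ ℚ.< ε → ∃[ N ] ∀ n → N ℕ.≤ n → seq x n ℚ.≤ seq y n ℚ.+ ε

_<ᵣ_ : ℝ → ℝ → Set
x <ᵣ y = ∃[ δ ] 0ℚ ℚ.< δ × ∃[ N ] ∀ n → N ℕ.≤ n → seq x n ℚ.+ δ ℚ.≤ seq y n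

fromℚ : ℚ → ℝ
fromℚ q .seq _ = q
fromℚ q .cauchy ε 0<ε = 0 , λ _ _ _ _ →
  subst (λ r → ℚ.∣ r ∣ ℚ.≤ ε) (sym (ℚ.+-inverseʳ q)) (ℚ.<⇒≤ 0<ε)

fromℕ : ℕ → ℝ
fromℕ n = fromℚ ((+ n) ℚ./ 1)

0ᵣ : ℝ
0ᵣ = fromℚ 0ℚ

∣_∣ᵣ : ℝ → ℝ
∣ x ∣ᵣ .seq n = ℚ.∣ seq x n ∣
∣ x ∣ᵣ .cauchy ε 0<ε with cauchy x ε 0<ε
... | N , close = N , λ m n N≤m N≤n →
  ℚ.≤-trans (∣∣p∣-∣q∣∣≤∣p-q∣ (seq x m) (seq x n)) (close m n N≤m N≤n)

_-ᵣ_ : ℝ → ℝ → ℝ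
(x -ᵣ y) .seq n = seq x n ℚ.- seq y n
(x -ᵣ y) .cauchy ε 0<ε
  with cauchy x (½ ℚ.* ε) (half-pos 0<ε) | cauchy y (½ ℚ.* ε) (half-pos 0<ε)
... | N₁ , close₁ | N₂ , close₂ = N₁ ℕ.⊔ N₂ , λ m n N≤m N≤n →
  let x≤ = close₁ m n (ℕ.m⊔n≤o⇒m≤o N₁ N₂ N≤m) (ℕ.m⊔n≤o⇒m≤o N₁ N₂ N≤n)
      y≤ = close₂ m n (ℕ.m⊔n≤o⇒n≤o N₁ N₂ N≤m) (ℕ.m⊔n≤o⇒n≤o N₁ N₂ N≤n)
  in subst₂ ℚ._≤_
       (cong ℚ.∣_∣ (regroup (seq x m) (seq y m) (seq x n) (seq y n)))
       (halves ε)
       (ℚ.≤-trans (ℚ.∣p-q∣≤∣p∣+∣q∣ (seq x m ℚ.- seq x n) (seq y m ℚ.- seq y n))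
                  (ℚ.+-mono-≤ x≤ y≤))
  where
  open +-*-Solver
  regroup : ∀ a b c d → (a ℚ.- c) ℚ.- (b ℚ.- d) ≡ (a ℚ.- b) ℚ.- (c ℚ.- d)
  regroup = solve 4 (λ a b c d → (a :- c) :- (b :- d) := (a :- b) :- (c :- d)) refl

private

  Bound : ℝ → Set
  Bound x = ∃[ B ] 0ℚ ℚ.< B × ∃[ N ] ∀ n → N ℕ.≤ n → ℚ.∣ seq x n ∣ ℚ.≤ B

  bounded : ∀ x → Bound x
  bounded x with cauchy x 1ℚ (ℚ.positive⁻¹ 1ℚ)
  ... | N , close =
    ℚ.∣ seq x N ∣ ℚ.+ 1ℚ ,
    ℚ.+-mono-≤-< (ℚ.0≤∣p∣ (seq x N)) (ℚ.positive⁻¹ 1ℚ) ,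
    N ,
    λ n N≤n → ℚ.≤-trans (∣p∣≤∣q∣+∣p-q∣ (seq x n) (seq x N))
                (ℚ.+-monoʳ-≤ ℚ.∣ seq x N ∣ (close n N N≤n ℕ.≤-refl))

  product-close : ∀ a b c d {A B δ} → 0ℚ ℚ.< δ → ℚ.∣ a ∣ ℚ.≤ A → ℚ.∣ d ∣ ℚ.≤ B →
                  ℚ.∣ a ℚ.- c ∣ ℚ.≤ δ → ℚ.∣ b ℚ.- d ∣ ℚ.≤ δ →
                  ℚ.∣ a ℚ.* b ℚ.- c ℚ.* d ∣ ℚ.≤ A ℚ.* δ ℚ.+ B ℚ.* δ
  product-close a b c d {A} {B} {δ} 0<δ a≤A d≤B a-c≤δ b-d≤δ = begin
    ℚ.∣ a ℚ.* b ℚ.- c ℚ.* d ∣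
      ≡⟨ cong ℚ.∣_∣ (expand a b c d) ⟨
    ℚ.∣ a ℚ.* (b ℚ.- d) ℚ.+ d ℚ.* (a ℚ.- c) ∣
      ≤⟨ ℚ.∣p+q∣≤∣p∣+∣q∣ (a ℚ.* (b ℚ.- d)) (d ℚ.* (a ℚ.- c)) ⟩
    ℚ.∣ a ℚ.* (b ℚ.- d) ∣ ℚ.+ ℚ.∣ d ℚ.* (a ℚ.- c) ∣
      ≡⟨ cong₂ ℚ._+_ (ℚ.∣p*q∣≡∣p∣*∣q∣ a (b ℚ.- d)) (ℚ.∣p*q∣≡∣p∣*∣q∣ d (a ℚ.- c)) ⟩
    ℚ.∣ a ∣ ℚ.* ℚ.∣ b ℚ.- d ∣ ℚ.+ ℚ.∣ d ∣ ℚ.* ℚ.∣ a ℚ.- c ∣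
      ≤⟨ ℚ.+-mono-≤
           (*-mono-≤ {ℚ.∣ a ∣} {A} {ℚ.∣ b ℚ.- d ∣} {δ}
             (ℚ.0≤∣p∣ a) (ℚ.<⇒≤ 0<δ) a≤A b-d≤δ)
           (*-mono-≤ {ℚ.∣ d ∣} {B} {ℚ.∣ a ℚ.- c ∣} {δ}
             (ℚ.0≤∣p∣ d) (ℚ.<⇒≤ 0<δ) d≤B a-c≤δ) ⟩
    A ℚ.* δ ℚ.+ B ℚ.* δ ∎
    where
    open ℚ.≤-Reasoning
    open +-*-Solver using (solve; _:+_; _:*_; _:-_; _:=_)
    expand : ∀ a b c d → a ℚ.* (b ℚ.- d) ℚ.+ d ℚ.* (a ℚ.- c) ≡ a ℚ.* b ℚ.- c ℚ.* d
    expand = solve 4 (λ a b c d →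
      a :* (b :- d) :+ d :* (a :- c) := a :* b :- c :* d) refl

  *-cauchy : ∀ x y → Bound x → Bound y → ∀ ε → 0ℚ ℚ.< ε →
             ∃[ N ] ∀ m n → N ℕ.≤ m → N ℕ.≤ n →
             ℚ.∣ seq x m ℚ.* seq y m ℚ.- seq x n ℚ.* seq y n ∣ ℚ.≤ ε
  *-cauchy x y (A , 0<A , K₁ , x≤A) (B , 0<B , K₂ , y≤B) ε 0<ε =
    N₁ ℕ.⊔ N₂ ℕ.⊔ (K₁ ℕ.⊔ K₂) , λ m n N≤m N≤n →
    let N≤m′ = ℕ.m⊔n≤o⇒m≤o (N₁ ℕ.⊔ N₂) (K₁ ℕ.⊔ K₂) N≤m
        N≤n′ = ℕ.m⊔n≤o⇒m≤o (N₁ ℕ.⊔ N₂) (K₁ ℕ.⊔ K₂) N≤n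
        K≤m  = ℕ.m⊔n≤o⇒n≤o (N₁ ℕ.⊔ N₂) (K₁ ℕ.⊔ K₂) N≤m
        K≤n  = ℕ.m⊔n≤o⇒n≤o (N₁ ℕ.⊔ N₂) (K₁ ℕ.⊔ K₂) N≤n
        dx   = close₁ m n (ℕ.m⊔n≤o⇒m≤o N₁ N₂ N≤m′) (ℕ.m⊔n≤o⇒m≤o N₁ N₂ N≤n′)
        dy   = close₂ m n (ℕ.m⊔n≤o⇒n≤o N₁ N₂ N≤m′) (ℕ.m⊔n≤o⇒n≤o N₁ N₂ N≤n′)
        xm   = x≤A m (ℕ.m⊔n≤o⇒m≤o K₁ K₂ K≤m)
        yn   = y≤B n (ℕ.m⊔n≤o⇒n≤o K₁ K₂ K≤n)
    in subst (ℚ.∣ seq x m ℚ.* seq y m ℚ.- seq x n ℚ.* seq y n ∣ ℚ.≤_) total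
         (product-close (seq x m) (seq y m) (seq x n) (seq y n) 0<δ xm yn dx dy)
    where
    open +-*-Solver

    0<A+B : 0ℚ ℚ.< A ℚ.+ B
    0<A+B = ℚ.+-mono-< {0ℚ} {A} {0ℚ} {B} 0<A 0<B

    δ : ℚ
    δ = recip (A ℚ.+ B) ℚ.* ε

    0<δ : 0ℚ ℚ.< δ
    0<δ = *-pos {recip (A ℚ.+ B)} {ε} (recip-pos {A ℚ.+ B} 0<A+B) 0<ε

    N₁ N₂ : ℕ
    N₁ = proj₁ (cauchy x δ 0<δ)
    N₂ = proj₁ (cauchy y δ 0<δ)
    close₁ = proj₂ (cauchy x δ 0<δ)
    close₂ = proj₂ (cauchy y δ 0<δ)

    collect : ∀ a b r e → a ℚ.* (r ℚ.* e) ℚ.+ b ℚ.* (r ℚ.* e) ≡ (r ℚ.* (a ℚ.+ b)) ℚ.* e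
    collect = solve 4 (λ a b r e →
      a :* (r :* e) :+ b :* (r :* e) := (r :* (a :+ b)) :* e) refl

    total : A ℚ.* δ ℚ.+ B ℚ.* δ ≡ ε
    total = trans
      (collect A B (recip (A ℚ.+ B)) ε)
      (trans (cong (ℚ._* ε) (recip-inverse {A ℚ.+ B} (>⇒≢ 0<A+B))) (ℚ.*-identityˡ ε))

_*ᵣ_ : ℝ → ℝ → ℝ
(x *ᵣ y) .seq n = seq x n ℚ.* seq y n
(x *ᵣ y) .cauchy = *-cauchy x y (bounded x) (bounded y)

-- The sequence of a positive real is eventually bounded away from 0, so the
-- convention for recip 0ℚ affects only finitely many terms.
inverse : (x : ℝ) → 0ᵣ <ᵣ x → ℝ
inverse x _ .seq n = recip (seq x n)
inverse x (δ , 0<δ , K , δ≤) .cauchy ε 0<ε = N ℕ.⊔ K , λ m n N≤m N≤n →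
  bound (seq x m) (seq x n)
    (lower m (ℕ.m⊔n≤o⇒n≤o N K N≤m)) (lower n (ℕ.m⊔n≤o⇒n≤o N K N≤n))
    (close m n (ℕ.m⊔n≤o⇒m≤o N K N≤m) (ℕ.m⊔n≤o⇒m≤o N K N≤n))
  where
  open +-*-Solver
  open import Algebra.Properties.CommutativeSemigroup
    (CommutativeMonoid.commutativeSemigroup ℚ.*-1-commutativeMonoid)
    using (interchange)

  rotate : ∀ r d a → r ℚ.* (d ℚ.* a) ≡ (r ℚ.* a) ℚ.* d
  rotate = solve 3 (λ r d a → r :* (d :* a) := (r :* a) :* d) refl

  collect : ∀ r s a b → r ℚ.* (s ℚ.* b) ℚ.- s ℚ.* (r ℚ.* a) ≡ (r ℚ.* s) ℚ.* (b ℚ.- a)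
  collect = solve 4 (λ r s a b →
    r :* (s :* b) :- s :* (r :* a) := (r :* s) :* (b :- a)) refl

  0<δδ : 0ℚ ℚ.< δ ℚ.* δ
  0<δδ = *-pos {δ} {δ} 0<δ 0<δ

  0<η : 0ℚ ℚ.< δ ℚ.* δ ℚ.* ε
  0<η = *-pos {δ ℚ.* δ} {ε} 0<δδ 0<ε

  N = proj₁ (cauchy x (δ ℚ.* δ ℚ.* ε) 0<η)
  close = proj₂ (cauchy x (δ ℚ.* δ ℚ.* ε) 0<η)

  lower : ∀ n → K ℕ.≤ n → δ ℚ.≤ seq x n
  lower n K≤n = subst (ℚ._≤ seq x n) (ℚ.+-identityˡ δ) (δ≤ n K≤n)

  D = recip δ
  0<D = recip-pos 0<δ

  recip≤D : ∀ a → δ ℚ.≤ a → recip a ℚ.≤ D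
  recip≤D a δ≤a = subst₂ ℚ._≤_ left right
    (*-mono-≤ {recip a} {recip a} {D ℚ.* δ} {D ℚ.* a}
      (ℚ.<⇒≤ 0<r) (ℚ.<⇒≤ (*-pos {D} {a} 0<D 0<a)) ℚ.≤-refl
      (ℚ.*-monoˡ-≤-nonNeg D {{ℚ.nonNegative (ℚ.<⇒≤ 0<D)}} δ≤a))
    where
    0<a = ℚ.<-≤-trans 0<δ δ≤a
    0<r = recip-pos 0<a
    left : recip a ℚ.* (D ℚ.* δ) ≡ recip a
    left = trans (cong (recip a ℚ.*_) (recip-inverse {δ} (>⇒≢ 0<δ))) (ℚ.*-identityʳ _)
    right : recip a ℚ.* (D ℚ.* a) ≡ D
    right = trans
      (rotate (recip a) D a)
      (trans (cong (ℚ._* D) (recip-inverse {a} (>⇒≢ 0<a))) (ℚ.*-identityˡ D))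

  bound : ∀ a b → δ ℚ.≤ a → δ ℚ.≤ b → ℚ.∣ a ℚ.- b ∣ ℚ.≤ δ ℚ.* δ ℚ.* ε →
          ℚ.∣ recip a ℚ.- recip b ∣ ℚ.≤ ε
  bound a b δ≤a δ≤b le = subst₂ ℚ._≤_ (sym lhs) rhs
    (*-mono-≤ {r ℚ.* s} {D ℚ.* D} {ℚ.∣ b ℚ.- a ∣} {δ ℚ.* δ ℚ.* ε}
      (ℚ.<⇒≤ (*-pos {r} {s} 0<r 0<s)) (ℚ.<⇒≤ 0<η)
      (*-mono-≤ {r} {D} {s} {D} (ℚ.<⇒≤ 0<r) (ℚ.<⇒≤ 0<D) (recip≤D a δ≤a) (recip≤D b δ≤b))
      (subst (ℚ._≤ δ ℚ.* δ ℚ.* ε) (∣-∣-sym a b) le))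
    where
    r = recip a
    s = recip b
    0<a = ℚ.<-≤-trans 0<δ δ≤a
    0<b = ℚ.<-≤-trans 0<δ δ≤b
    0<r = recip-pos 0<a
    0<s = recip-pos 0<b
    factor : r ℚ.- s ≡ (r ℚ.* s) ℚ.* (b ℚ.- a)
    factor = trans
      (cong₂ ℚ._-_
        (sym (trans (cong (r ℚ.*_) (recip-inverse {b} (>⇒≢ 0<b))) (ℚ.*-identityʳ r)))
        (sym (trans (cong (s ℚ.*_) (recip-inverse {a} (>⇒≢ 0<a))) (ℚ.*-identityʳ s))))
      (collect r s a b)
    lhs : ℚ.∣ r ℚ.- s ∣ ≡ (r ℚ.* s) ℚ.* ℚ.∣ b ℚ.- a ∣
    lhs = trans (cong ℚ.∣_∣ factor)
      (trans (ℚ.∣p*q∣≡∣p∣*∣q∣ (r ℚ.* s) (b ℚ.- a))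
        (cong (ℚ._* ℚ.∣ b ℚ.- a ∣) (ℚ.0≤p⇒∣p∣≡p (ℚ.<⇒≤ (*-pos {r} {s} 0<r 0<s)))))
    rhs : (D ℚ.* D) ℚ.* (δ ℚ.* δ ℚ.* ε) ≡ ε
    rhs = trans
      (sym (ℚ.*-assoc (D ℚ.* D) (δ ℚ.* δ) ε))
      (trans (cong (ℚ._* ε) (interchange D D δ δ))
      (trans (cong (λ t → t ℚ.* t ℚ.* ε) (recip-inverse {δ} (>⇒≢ 0<δ)))
        (trans (cong (ℚ._* ε) (ℚ.*-identityˡ 1ℚ)) (ℚ.*-identityˡ ε))))

_/ᵣ_⟨_⟩ : (x y : ℝ) → 0ᵣ <ᵣ y → ℝ
x /ᵣ y ⟨ 0<y ⟩ = x *ᵣ inverse y 0<y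

-- ⌊ a ^ (1/q) · K ⌋, i.e. the greatest m with m ^ q ≤ a · K ^ q; the bound
-- given to the search is harmless because m ≤ m ^ q.
rootFloor : (q : ℕ) .{{_ : NonZero q}} (a K : ℕ) → ℕ
rootFloor q a K = greatest (λ m → m ^ q ≤? a ℕ.* K ^ q) (a ℕ.* K ^ q)

private

  m≤m^q : ∀ m q .{{_ : NonZero q}} → m ℕ.≤ m ^ q
  m≤m^q zero    q       = ℕ.z≤n
  m≤m^q (suc m) (suc q) = ℕ.m≤m*n (suc m) (suc m ^ q) {{ℕ.m^n≢0 (suc m) q}}

  0^q : ∀ q .{{_ : NonZero q}} → 0 ^ q ≡ 0
  0^q (suc q) = refl

  ^-distribʳ-* : ∀ q m n → (m ℕ.* n) ^ q ≡ m ^ q ℕ.* n ^ q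
  ^-distribʳ-* zero    m n = refl
  ^-distribʳ-* (suc q) m n =
    trans (cong (m ℕ.* n ℕ.*_) (^-distribʳ-* q m n))
      (solve 4 (λ m n x y → m :* n :* (x :* y) := m :* x :* (n :* y))
        refl m n (m ^ q) (n ^ q))
    where
    open import Data.Nat.Solver renaming (module +-*-Solver to ℕ-Solver)
    open ℕ-Solver

  ^-cancelʳ-< : ∀ q {m n} → m ^ q ℕ.< n ^ q → m ℕ.< n
  ^-cancelʳ-< q {m} {n} lt with m ℕ.<? n
  ... | yes m<n = m<n
  ... | no  m≮n = ⊥-elim (ℕ.<⇒≱ lt (ℕ.^-monoˡ-≤ q (ℕ.≮⇒≥ m≮n)))

rootFloor-lower : ∀ q .{{_ : NonZero q}} a K → rootFloor q a K ^ q ℕ.≤ a ℕ.* K ^ q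
rootFloor-lower q a K =
  greatest-holds (λ m → m ^ q ≤? a ℕ.* K ^ q)
    (subst (ℕ._≤ a ℕ.* K ^ q) (sym (0^q q)) ℕ.z≤n) (a ℕ.* K ^ q)

rootFloor-max : ∀ q .{{_ : NonZero q}} a K {m} → m ^ q ℕ.≤ a ℕ.* K ^ q →
                m ℕ.≤ rootFloor q a K
rootFloor-max q a K {m} le =
  greatest-max (λ m → m ^ q ≤? a ℕ.* K ^ q) (a ℕ.* K ^ q)
    (ℕ.≤-trans (m≤m^q m q) le) le

rootFloor-upper : ∀ q .{{_ : NonZero q}} a K →
                  a ℕ.* K ^ q ℕ.< suc (rootFloor q a K) ^ q
rootFloor-upper q a K = ℕ.≰⇒> λ le → ℕ.1+n≰n (rootFloor-max q a K le)

private

  rootFloor-cross : ∀ q .{{_ : NonZero q}} a K K′ .{{_ : NonZero K′}} .{{_ : NonZero K}} →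
    rootFloor q a K ℕ.* K′ ℕ.< suc (rootFloor q a K′) ℕ.* K
  rootFloor-cross q a K K′ = ^-cancelʳ-< q
    (subst₂ ℕ._<_ (sym (^-distribʳ-* q r K′)) (sym (^-distribʳ-* q (suc r′) K))
      (ℕ.≤-<-trans (ℕ.*-monoˡ-≤ (K′ ^ q) (rootFloor-lower q a K))
        (subst (ℕ._< suc r′ ^ q ℕ.* K ^ q) swap
          (ℕ.*-monoˡ-< (K ^ q) {{ℕ.m^n≢0 K q}} (rootFloor-upper q a K′)))))
    where
    r  = rootFloor q a K
    r′ = rootFloor q a K′
    swap : a ℕ.* K′ ^ q ℕ.* K ^ q ≡ a ℕ.* K ^ q ℕ.* K′ ^ q
    swap = trans (ℕ.*-assoc a _ _)
      (trans (cong (a ℕ.*_) (ℕ.*-comm (K′ ^ q) (K ^ q))) (sym (ℕ.*-assoc a _ _)))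

-- The q-th root of a, as the limit of ⌊ a ^ (1/q) · (k+1) ⌋ / (k+1) for k → ∞.
root : (q : ℕ) .{{_ : NonZero q}} → ℕ → ℝ
root q a .seq k = (+ rootFloor q a (suc k)) ℚ./ suc k
root q a .cauchy ε 0<ε = ℚ.denominatorℕ ε , λ m n d≤m d≤n →
  ∣p∣≤-intro
    (half m n d≤n)
    (subst (ℚ._≤ ε) (sym (neg-sub (root q a .seq m) (root q a .seq n)))
      (half n m d≤m))
  where
  half : ∀ m n → ℚ.denominatorℕ ε ℕ.≤ n →
         root q a .seq m ℚ.- root q a .seq n ℚ.≤ ε
  half m n d≤n = ≤-sub (ℚ.≤-trans
    (subst (root q a .seq m ℚ.≤_) (/-suc (rootFloor q a (suc n)) n)
      (/-mono (rootFloor q a (suc m)) m (suc (rootFloor q a (suc n))) n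
        (ℕ.<⇒≤ (rootFloor-cross q a (suc m) (suc n)))))
    (ℚ.+-monoʳ-≤ (root q a .seq n) (1/-≤ ε 0<ε n (ℕ.m≤n⇒m≤1+n d≤n))))

root-pos : ∀ q .{{_ : NonZero q}} a .{{_ : NonZero a}} → 0ᵣ <ᵣ root q a
root-pos q a = 1ℚ , ℚ.positive⁻¹ 1ℚ , 0 , λ k _ →
  subst (ℚ._≤ root q a .seq k) (sym (ℚ.+-identityˡ 1ℚ))
    (/-mono 1 0 (rootFloor q a (suc k)) k
      (subst₂ ℕ._≤_ (sym (ℕ.*-identityˡ (suc k)))
        (sym (ℕ.*-identityʳ (rootFloor q a (suc k))))
        (rootFloor-max q a (suc k) (ℕ.m≤n*m (suc k ^ q) a))))

_^[_/_] : ℕ → (a b : ℕ) .{{_ : NonZero b}} → ℝ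
n ^[ a / b ] = root b (n ^ a)

^[/]-pos : ∀ n a b .{{_ : NonZero n}} .{{_ : NonZero b}} → 0ᵣ <ᵣ n ^[ a / b ]
^[/]-pos n a b = root-pos b (n ^ a) {{ℕ.m^n≢0 n a}}

-- Indexed by the positive integers: 1/n^s and n-th roots need n ≠ 0.
Sequence : Set
Sequence = (n : ℕ) .{{_ : NonZero n}} → ℝ

infix 4 _≫_ _⟶_

_≫_ : Sequence → Sequence → Set
f ≫ g = ∃[ c ] 0ᵣ <ᵣ c × ∃[ n₀ ] ∀ n .{{_ : NonZero n}} → n₀ ℕ.< n →
        c *ᵣ g n ≤ᵣ f n

_⟶_ : Sequence → ℝ → Set
s ⟶ l = ∀ ε → 0ᵣ <ᵣ ε → ∃[ n₀ ] ∀ n .{{_ : NonZero n}} → n₀ ℕ.< n →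
        ∣ s n -ᵣ l ∣ᵣ ≤ᵣ ε

capSizes : (p : ℕ) .{{_ : NonZero p}} → Sequence
capSizes p n = fromℕ (maxCapSize n p)

capSizeRoots : (p : ℕ) .{{_ : NonZero p}} → Sequence
capSizeRoots p n = root n (maxCapSize n p)

_^n/n^[_/_] : ℕ → (a b : ℕ) .{{_ : NonZero b}} → Sequence
(m ^n/n^[ a / b ]) n = fromℕ (m ^ n) /ᵣ n ^[ a / b ] ⟨ ^[/]-pos n a b ⟩

{-# OPTIONS --safe #-}

-- Fix m = k + 2 digits in ℤ/pℤ and consider the words over them in which every
-- digit other than the first two occurs a prescribed number of times.
-- Suppose that for every ratio t ∉ {0, −1} there are functions f, g, h on the digits,
-- equal on the first two, such that f + g + h is constant with value C and
-- f x + g y + h z > C for all distinct digits x, y, z on a line with ratio t.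
-- Summing over the coordinates, distinct words x, y, z on a line with ratio t
-- give ∑ (f xᵢ + g yᵢ + h zᵢ) > n C, while prescribed counts force equality.
-- So these words form a cap. By Chebyshev at least half of all mⁿ words have
-- all counts within O(√n) of n / m, hence by the pigeonhole principle some
-- choice of the k counts is shared by at least c mⁿ / n^(k/2) words.

module Submission where

open import Data.Nat as ℕ hiding (_≟_)
open import Data.Nat.Properties as ℕ hiding (_≟_)
open import Data.Nat.DivMod
open import Data.Nat.ListAction using (sum)
open import Data.Nat.ListAction.Properties using (sum-++)
open import Data.Nat.Solver using (module +-*-Solver)
open import Data.Integer as ℤ using () renaming (+_ to pos)
import Data.Integer.Properties as ℤ
open import Data.Rational as ℚ using (ℚ; 0ℚ; ½)
import Data.Rational.Properties as ℚ
open import Data.Rational.Solver renaming (module +-*-Solver to ℚ-Solver)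
import Data.Rational.Unnormalised as ℚᵘ
import Data.Rational.Unnormalised.Properties as ℚᵘ
open import Data.Fin using (Fin; zero; suc; toℕ; funToFin)
open import Data.Fin.Properties
  using (_≟_; all?; any?; toℕ-fromℕ<; toℕ-injective; finToFun-funToFin)
open import Data.Fin.Subset using (Subset; _∪_; ⁅_⁆; ∣_∣)
  renaming (_∈_ to _∈ₛ_; ⊥ to ∅)
open import Data.Fin.Subset.Properties
  using (∉⊥; x∈p∪q⁻; x∈⁅y⁆⇒x≡y; x∈⁅x⁆; p⊆p∪q; q⊆p∪q; p⊂q⇒∣p∣<∣q∣)
open import Data.List as List
  using (List; []; _∷_; _++_; length; map; concatMap; filter; allFin;
         cartesianProduct; cartesianProductWith)
open import Data.List.Properties
  using (length-map; length-tabulate; map-cong; map-++; map-∘; map-tabulate)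
open import Data.List.Membership.Propositional using (_∈_)
open import Data.List.Membership.Propositional.Properties
open import Data.List.Relation.Unary.All as All using (All; []; _∷_)
import Data.List.Relation.Unary.All.Properties as All
open import Data.List.Relation.Unary.AllPairs using ([]; _∷_)
open import Data.List.Relation.Unary.Any as Any using (Any; here; there)
open import Data.List.Relation.Unary.Unique.Propositional using (Unique)
import Data.List.Relation.Unary.Unique.Propositional.Properties as Unique
open import Data.List.Relation.Binary.Sublist.Propositional
  using (_⊆_; []; _∷_; _∷ʳ_; ⊆-refl; ⊆-trans)
import Data.List.Relation.Binary.Sublist.Propositional.Properties as Sublist
open import Data.Vec using (Vec; []; _∷_; lookup)
import Data.Vec.Properties as Vec
open import Data.Product using (∃-syntax; Σ-syntax; _×_; _,_; proj₁; proj₂)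
open import Data.Sum using (_⊎_; inj₁; inj₂)
open import Data.Empty using (⊥-elim)
open import Data.Unit using (tt)
open import Function using (_∘_; it)
open import Level using (0ℓ)
open import Relation.Nullary using (¬_; Dec; yes; no; ¬?; contradiction)
open import Relation.Nullary.Decidable using (_×-dec_; _→-dec_; _⊎-dec_; toWitness; map′)
open import Relation.Unary using (Pred; Decidable)
open import Relation.Binary.PropositionalEquality
  using (_≡_; _≢_; refl; sym; trans; cong; cong₂; subst; subst₂; module ≡-Reasoning)
open import Defs

-- What the coordinates of a line share is its ratio: a dependency a (y - x) + b (z - x) = 0 with a
-- ≠ 0 projects, in every coordinate, to a line of digits (possibly a single point) with the same t
-- = b / a. So the weights may depend on t, and each ratio is a separate finite problem about
-- digits. Prescribing all m counts would be m - 1 independent conditions and cost a factor n^((m -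
-- 1)/2). Equal weights on the first two digits make only their total count matter, and the other k
-- = m - 2 counts determine that total; this gains √n and gives the exponents 3/2, 5/2, 7/2, 4 and
-- 5. For the limits any polynomial loss is harmless. As convergence is a hypothesis there, one good
-- n beyond each bound suffices.

private variable
  A B : Set

-- Words and their digit counts

∑ : List A → (A → ℕ) → ℕ
∑ xs f = sum (map f xs)

syntax ∑ xs (λ x → e) = ∑[ x ∈ xs ] e
infixr 8 ∑

∑-cong : ∀ (xs : List A) {f g : A → ℕ} → (∀ x → f x ≡ g x) → ∑ xs f ≡ ∑ xs g
∑-cong xs f≗g = cong sum (map-cong f≗g xs)

∑-const : ∀ (xs : List A) c → ∑[ _ ∈ xs ] c ≡ length xs * c
∑-const []       c = refl
∑-const (_ ∷ xs) c = cong (c +_) (∑-const xs c)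

∑-+ : ∀ (xs : List A) (f g : A → ℕ) → ∑[ x ∈ xs ] (f x + g x) ≡ ∑ xs f + ∑ xs g
∑-+ []       f g = refl
∑-+ (x ∷ xs) f g = trans (cong (f x + g x +_) (∑-+ xs f g))
  (solve 4 (λ a b s t → a :+ b :+ (s :+ t) := a :+ s :+ (b :+ t)) refl
    (f x) (g x) (∑ xs f) (∑ xs g))
  where open +-*-Solver

∑-*ˡ : ∀ (xs : List A) c (f : A → ℕ) → ∑[ x ∈ xs ] (c * f x) ≡ c * ∑ xs f
∑-*ˡ []       c f = sym (*-zeroʳ c)
∑-*ˡ (x ∷ xs) c f =
  trans (cong (c * f x +_) (∑-*ˡ xs c f)) (sym (*-distribˡ-+ c (f x) (∑ xs f)))

∑-mono-≤ : ∀ (xs : List A) {f g : A → ℕ} → (∀ x → f x ≤ g x) → ∑ xs f ≤ ∑ xs g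
∑-mono-≤ []       f≤g = z≤n
∑-mono-≤ (x ∷ xs) f≤g = +-mono-≤ (f≤g x) (∑-mono-≤ xs f≤g)

∑-swap : ∀ (xs : List A) (ys : List B) (f : A → B → ℕ) →
         ∑[ x ∈ xs ] ∑[ y ∈ ys ] f x y ≡ ∑[ y ∈ ys ] ∑[ x ∈ xs ] f x y
∑-swap []       ys f = sym (trans (∑-const ys 0) (*-zeroʳ (length ys)))
∑-swap (x ∷ xs) ys f =
  trans (cong (∑ ys (f x) +_) (∑-swap xs ys f)) (sym (∑-+ ys (f x) _))

∑-++ : ∀ (xs ys : List A) f → ∑ (xs ++ ys) f ≡ ∑ xs f + ∑ ys f
∑-++ xs ys f = trans (cong sum (map-++ f xs ys)) (sum-++ (map f xs) (map f ys))

∑-cartesianProductWith : ∀ {C : Set} (h : A → B → C) xs ys f →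
  ∑ (cartesianProductWith h xs ys) f ≡ ∑[ x ∈ xs ] ∑[ y ∈ ys ] f (h x y)
∑-cartesianProductWith h []       ys f = refl
∑-cartesianProductWith h (x ∷ xs) ys f = trans
  (∑-++ (map (h x) ys) (cartesianProductWith h xs ys) f)
  (cong₂ _+_ (cong sum (sym (map-∘ ys))) (∑-cartesianProductWith h xs ys f))

∑-allFin-suc : ∀ {m} (f : Fin (suc m) → ℕ) →
  ∑ (allFin (suc m)) f ≡ f zero + ∑ (allFin m) (f ∘ suc)
∑-allFin-suc {m} f = cong (λ l → f zero + sum l)
  (trans (map-tabulate {n = m} suc f) (sym (map-tabulate {n = m} (λ i → i) (f ∘ suc))))

term≤∑ : ∀ {m} (f : Fin m → ℕ) i → f i ≤ ∑ (allFin m) f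
term≤∑ {suc m} f i = subst (f i ≤_) (sym (∑-allFin-suc f)) (bound i)
  where
  bound : ∀ i → f i ≤ f zero + ∑ (allFin m) (f ∘ suc)
  bound zero    = m≤m+n _ _
  bound (suc i) = ≤-trans (term≤∑ (f ∘ suc) i) (m≤n+m _ _)

δ : ∀ {m} → Fin m → Fin m → ℕ
δ zero    zero    = 1
δ zero    (suc _) = 0
δ (suc _) zero    = 0
δ (suc i) (suc j) = δ i j

δ-idem : ∀ {m} (i j : Fin m) → δ i j * δ i j ≡ δ i j
δ-idem zero    zero    = refl
δ-idem zero    (suc _) = refl
δ-idem (suc _) zero    = refl
δ-idem (suc i) (suc j) = δ-idem i j

δ-comm : ∀ {m} (i j : Fin m) → δ i j ≡ δ j i
δ-comm zero    zero    = refl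
δ-comm zero    (suc _) = refl
δ-comm (suc _) zero    = refl
δ-comm (suc i) (suc j) = δ-comm i j

∑-*δ : ∀ {m} (f : Fin m → ℕ) j → ∑[ i ∈ allFin m ] (f i * δ i j) ≡ f j
∑-*δ {suc m} f j = trans (∑-allFin-suc (λ i → f i * δ i j)) (eval j)
  where
  eval : ∀ j → f zero * δ zero j + ∑[ i ∈ allFin m ] (f (suc i) * δ (suc i) j) ≡ f j
  eval zero = trans
    (cong₂ _+_ (*-identityʳ (f zero))
      (trans (∑-cong (allFin m) (λ i → *-zeroʳ (f (suc i))))
        (trans (∑-const (allFin m) 0) (*-zeroʳ (length (allFin m))))))
    (+-identityʳ (f zero))
  eval (suc j) = cong₂ _+_ (*-zeroʳ (f zero)) (∑-*δ (f ∘ suc) j)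

∑-δ : ∀ {m} (i : Fin m) → ∑ (allFin m) (δ i) ≡ 1
∑-δ {m} i = trans
  (∑-cong (allFin m) (λ j → trans (δ-comm i j) (sym (+-identityʳ (δ j i)))))
  (∑-*δ (λ _ → 1) i)

Word : ℕ → ℕ → Set
Word m n = Vec (Fin m) n

words : ∀ m n → List (Word m n)
words m zero    = [] ∷ []
words m (suc n) = cartesianProductWith _∷_ (allFin m) (words m n)

words-unique : ∀ m n → Unique (words m n)
words-unique m zero    = [] ∷ []
words-unique m (suc n) = Unique.cartesianProductWith⁺ _∷_ Vec.∷-injective
  (Unique.allFin⁺ m) (words-unique m n)

length≡∑1 : ∀ (xs : List A) → length xs ≡ ∑[ _ ∈ xs ] 1
length≡∑1 xs = sym (trans (∑-const xs 1) (*-identityʳ (length xs)))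

length-words : ∀ m n → length (words m n) ≡ m ^ n
length-words m zero    = refl
length-words m (suc n) = begin
  length (words m (suc n))
    ≡⟨ length≡∑1 (words m (suc n)) ⟩
  ∑[ _ ∈ words m (suc n) ] 1
    ≡⟨ ∑-cartesianProductWith _∷_ (allFin m) (words m n) (λ _ → 1) ⟩
  ∑[ _ ∈ allFin m ] ∑[ _ ∈ words m n ] 1
    ≡⟨ ∑-const (allFin m) _ ⟩
  length (allFin m) * ∑[ _ ∈ words m n ] 1
    ≡⟨ cong₂ _*_ (length-tabulate {n = m} (λ i → i))
         (trans (sym (length≡∑1 (words m n))) (length-words m n)) ⟩
  m * m ^ n ∎
  where open ≡-Reasoning

weight : ∀ {m n} → (Fin m → ℕ) → Word m n → ℕ
weight f []      = 0
weight f (d ∷ w) = f d + weight f w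

occ : ∀ {m n} → Fin m → Word m n → ℕ
occ e = weight (δ e)

weight≡∑occ : ∀ {m n} (f : Fin m → ℕ) (w : Word m n) →
  weight f w ≡ ∑[ e ∈ allFin m ] (f e * occ e w)
weight≡∑occ {m} f [] = sym (trans
  (∑-cong (allFin m) (λ e → *-zeroʳ (f e)))
  (trans (∑-const (allFin m) 0) (*-zeroʳ (length (allFin m)))))
weight≡∑occ {m} f (d ∷ w) = sym (begin
  ∑[ e ∈ allFin m ] (f e * (δ e d + occ e w))
    ≡⟨ ∑-cong (allFin m) (λ e → *-distribˡ-+ (f e) (δ e d) (occ e w)) ⟩
  ∑[ e ∈ allFin m ] (f e * δ e d + f e * occ e w)
    ≡⟨ ∑-+ (allFin m) (λ e → f e * δ e d) _ ⟩
  ∑[ e ∈ allFin m ] (f e * δ e d) + ∑[ e ∈ allFin m ] (f e * occ e w)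
    ≡⟨ cong₂ _+_ (∑-*δ f d) (sym (weight≡∑occ f w)) ⟩
  f d + weight f w ∎)
  where open ≡-Reasoning

-- Moments of the number of occurrences of a digit

module _ {m : ℕ} (e : Fin m) where

  private
    S₁ S₂ : ℕ → ℕ
    S₁ n = ∑ (words m n) (occ e)
    S₂ n = ∑[ w ∈ words m n ] (occ e w * occ e w)

    ∑δ+ : ∀ a b → ∑[ d ∈ allFin m ] (a * δ e d + b) ≡ a + m * b
    ∑δ+ a b = begin
      ∑[ d ∈ allFin m ] (a * δ e d + b)
        ≡⟨ ∑-+ (allFin m) (λ d → a * δ e d) (λ _ → b) ⟩
      ∑[ d ∈ allFin m ] (a * δ e d) + ∑[ _ ∈ allFin m ] b
        ≡⟨ cong₂ _+_ (∑-*ˡ (allFin m) a (δ e)) (∑-const (allFin m) b) ⟩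
      a * ∑ (allFin m) (δ e) + length (allFin m) * b
        ≡⟨ cong₂ _+_ (trans (cong (a *_) (∑-δ e)) (*-identityʳ a))
             (cong (_* b) (length-tabulate {n = m} (λ i → i))) ⟩
      a + m * b ∎
      where open ≡-Reasoning

    ∑const-words : ∀ n c → ∑[ _ ∈ words m n ] c ≡ m ^ n * c
    ∑const-words n c = trans (∑-const (words m n) c) (cong (_* c) (length-words m n))

    S₁-suc : ∀ n → S₁ (suc n) ≡ m ^ n + m * S₁ n
    S₁-suc n = begin
      S₁ (suc n)
        ≡⟨ ∑-cartesianProductWith _∷_ (allFin m) (words m n) (occ e) ⟩
      ∑[ d ∈ allFin m ] ∑[ w ∈ words m n ] (δ e d + occ e w)
        ≡⟨ ∑-cong (allFin m) (λ d → trans (∑-+ (words m n) _ _)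
             (cong (_+ S₁ n) (∑const-words n (δ e d)))) ⟩
      ∑[ d ∈ allFin m ] (m ^ n * δ e d + S₁ n)
        ≡⟨ ∑δ+ (m ^ n) (S₁ n) ⟩
      m ^ n + m * S₁ n ∎
      where open ≡-Reasoning

    S₂-suc : ∀ n → S₂ (suc n) ≡ (m ^ n + 2 * S₁ n) + m * S₂ n
    S₂-suc n = begin
      S₂ (suc n)
        ≡⟨ ∑-cartesianProductWith _∷_ (allFin m) (words m n) _ ⟩
      ∑[ d ∈ allFin m ] ∑[ w ∈ words m n ] ((δ e d + occ e w) * (δ e d + occ e w))
        ≡⟨ ∑-cong (allFin m) inner ⟩
      ∑[ d ∈ allFin m ] ((m ^ n + 2 * S₁ n) * δ e d + S₂ n)
        ≡⟨ ∑δ+ (m ^ n + 2 * S₁ n) (S₂ n) ⟩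
      (m ^ n + 2 * S₁ n) + m * S₂ n ∎
      where
      open ≡-Reasoning
      open +-*-Solver
      square : ∀ d o → (δ e d + o) * (δ e d + o) ≡ δ e d + 2 * δ e d * o + o * o
      square d o = trans
        (solve 2 (λ x o → (x :+ o) :* (x :+ o) := x :* x :+ con 2 :* x :* o :+ o :* o)
          refl (δ e d) o)
        (cong (λ s → s + 2 * δ e d * o + o * o) (δ-idem e d))
      inner : ∀ d → ∑[ w ∈ words m n ] ((δ e d + occ e w) * (δ e d + occ e w))
                  ≡ (m ^ n + 2 * S₁ n) * δ e d + S₂ n
      inner d = begin
        ∑[ w ∈ words m n ] ((δ e d + occ e w) * (δ e d + occ e w))
          ≡⟨ ∑-cong (words m n) (λ w → square d (occ e w)) ⟩
        ∑[ w ∈ words m n ] (δ e d + 2 * δ e d * occ e w + occ e w * occ e w)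
          ≡⟨ ∑-+ (words m n) (λ w → δ e d + 2 * δ e d * occ e w) _ ⟩
        ∑[ w ∈ words m n ] (δ e d + 2 * δ e d * occ e w) + S₂ n
          ≡⟨ cong (_+ S₂ n) (trans (∑-+ (words m n) (λ _ → δ e d) _)
               (cong₂ _+_ (∑const-words n (δ e d)) (∑-*ˡ (words m n) (2 * δ e d) (occ e)))) ⟩
        m ^ n * δ e d + 2 * δ e d * S₁ n + S₂ n
          ≡⟨ cong (_+ S₂ n) (solve 3 (λ p x s → p :* x :+ con 2 :* x :* s
               := (p :+ con 2 :* s) :* x) refl (m ^ n) (δ e d) (S₁ n)) ⟩
        (m ^ n + 2 * S₁ n) * δ e d + S₂ n ∎

    first-moment : ∀ n → m * S₁ n ≡ n * m ^ n
    first-moment zero    = *-zeroʳ m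
    first-moment (suc n) = begin
      m * S₁ (suc n)              ≡⟨ cong (m *_) (S₁-suc n) ⟩
      m * (m ^ n + m * S₁ n)      ≡⟨ cong (λ s → m * (m ^ n + s)) (first-moment n) ⟩
      m * (m ^ n + n * m ^ n)     ≡⟨ solve 3 (λ m n p → m :* (p :+ n :* p)
                                       := (con 1 :+ n) :* (m :* p)) refl m n (m ^ n) ⟩
      suc n * m ^ suc n           ∎
      where
      open ≡-Reasoning
      open +-*-Solver

    -- The count is binomial with success probability 1 / m: squared mean n² / m² plus variance n (m
    -- - 1) / m², cleared of denominators and of subtraction.
    second-moment : ∀ n → m * m * S₂ n + n * m ^ n ≡ m ^ n * (n * n + m * n)
    second-moment zero    = trans (+-identityʳ _) (trans (*-zeroʳ (m * m))
      (sym (trans (+-identityʳ _) (*-zeroʳ m))))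
    second-moment (suc n) = begin
      m * m * S₂ (suc n) + suc n * (m * m ^ n)
        ≡⟨ cong (λ s → m * m * s + suc n * (m * m ^ n)) (S₂-suc n) ⟩
      m * m * ((m ^ n + 2 * S₁ n) + m * S₂ n) + suc n * (m * m ^ n)
        ≡⟨ solve 5 (λ m n p s₁ s₂ →
             m :* m :* ((p :+ con 2 :* s₁) :+ m :* s₂) :+ (con 1 :+ n) :* (m :* p)
             := m :* (m :* p :+ con 2 :* (m :* s₁) :+ (m :* m :* s₂ :+ n :* p) :+ p))
             refl m n (m ^ n) (S₁ n) (S₂ n) ⟩
      m * (m * m ^ n + 2 * (m * S₁ n) + (m * m * S₂ n + n * m ^ n) + m ^ n)
        ≡⟨ cong₂ (λ s t → m * (m * m ^ n + 2 * s + t + m ^ n))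
             (first-moment n) (second-moment n) ⟩
      m * (m * m ^ n + 2 * (n * m ^ n) + m ^ n * (n * n + m * n) + m ^ n)
        ≡⟨ solve 3 (λ m n p →
             m :* (m :* p :+ con 2 :* (n :* p) :+ p :* (n :* n :+ m :* n) :+ p)
             := m :* p :* ((con 1 :+ n) :* (con 1 :+ n) :+ m :* (con 1 :+ n)))
             refl m n (m ^ n) ⟩
      m ^ suc n * (suc n * suc n + m * suc n) ∎
      where
      open ≡-Reasoning
      open +-*-Solver

  -- m² times the squared distance of the count from its mean n / m; the scaling keeps it a natural
  -- number.
  deviation : ∀ {n} → Word m n → ℕ
  deviation {n} w = ∣ m * occ e w - n ∣ * ∣ m * occ e w - n ∣

  private
    square-∣-∣ : ∀ a b → ∣ a - b ∣ * ∣ a - b ∣ + 2 * b * a ≡ a * a + b * b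
    square-∣-∣ a b with ≤-total a b
    ... | inj₁ a≤b = trans
      (cong₂ (λ x b → x * x + 2 * b * a) (m≤n⇒∣m-n∣≡n∸m a≤b) (sym (m+[n∸m]≡n a≤b)))
      (trans (solve 2 (λ a c → c :* c :+ con 2 :* (a :+ c) :* a
                               := a :* a :+ (a :+ c) :* (a :+ c)) refl a (b ∸ a))
        (cong (λ b → a * a + b * b) (m+[n∸m]≡n a≤b)))
      where open +-*-Solver
    ... | inj₂ b≤a = trans
      (cong₂ (λ x a → x * x + 2 * b * a) (m≤n⇒∣n-m∣≡n∸m b≤a) (sym (m+[n∸m]≡n b≤a)))
      (trans (solve 2 (λ b c → c :* c :+ con 2 :* b :* (b :+ c)
                               := (b :+ c) :* (b :+ c) :+ b :* b) refl b (a ∸ b))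
        (cong (λ a → a * a + b * b) (m+[n∸m]≡n b≤a)))
      where open +-*-Solver

  ∑-deviation : ∀ n → ∑ (words m n) deviation ≤ m ^ n * (m * n)
  -- `D + n * m ^ n` equals the bound exactly. The cross term `E` of the expanded square is carried
  -- on both sides instead of being subtracted, then cancelled.
  ∑-deviation n = m+n≤o⇒m≤o D (≤-reflexive (+-cancelʳ-≡ E _ _ (begin
    D + n * m ^ n + E
      ≡⟨ solve 3 (λ D q E → D :+ q :+ E := (D :+ E) :+ q) refl D (n * m ^ n) E ⟩
    (D + E) + n * m ^ n
      ≡⟨ cong (_+ n * m ^ n) D+E ⟩
    m * m * S₂ n + m ^ n * (n * n) + n * m ^ n
      ≡⟨ solve 3 (λ a b c → a :+ b :+ c := (a :+ c) :+ b) refl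
           (m * m * S₂ n) (m ^ n * (n * n)) (n * m ^ n) ⟩
    (m * m * S₂ n + n * m ^ n) + m ^ n * (n * n)
      ≡⟨ cong (_+ m ^ n * (n * n)) (second-moment n) ⟩
    m ^ n * (n * n + m * n) + m ^ n * (n * n)
      ≡⟨ solve 3 (λ m n p → p :* (n :* n :+ m :* n) :+ p :* (n :* n)
             := p :* (m :* n) :+ con 2 :* n :* (n :* p)) refl m n (m ^ n) ⟩
    m ^ n * (m * n) + E ∎)))
    where
    open ≡-Reasoning
    open +-*-Solver
    D = ∑ (words m n) deviation
    E = 2 * n * (n * m ^ n)
    D+E : D + E ≡ m * m * S₂ n + m ^ n * (n * n)
    D+E = begin
      D + E
        ≡⟨ cong (λ s → D + 2 * n * s) (first-moment n) ⟨
      D + 2 * n * (m * S₁ n)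
        ≡⟨ cong (D +_) (trans (sym (*-assoc (2 * n) m (S₁ n)))
             (sym (∑-*ˡ (words m n) (2 * n * m) (occ e)))) ⟩
      D + ∑[ w ∈ words m n ] (2 * n * m * occ e w)
        ≡⟨ ∑-+ (words m n) deviation _ ⟨
      ∑[ w ∈ words m n ] (deviation w + 2 * n * m * occ e w)
        ≡⟨ ∑-cong (words m n) (λ w → trans
             (cong (deviation w +_) (*-assoc (2 * n) m (occ e w)))
             (square-∣-∣ (m * occ e w) n)) ⟩
      ∑[ w ∈ words m n ] (m * occ e w * (m * occ e w) + n * n)
        ≡⟨ ∑-+ (words m n) _ (λ _ → n * n) ⟩
      ∑[ w ∈ words m n ] (m * occ e w * (m * occ e w)) + ∑[ _ ∈ words m n ] (n * n)
        ≡⟨ cong₂ _+_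
             (trans (∑-cong (words m n) (λ w → solve 2 (λ m o →
                       m :* o :* (m :* o) := m :* m :* (o :* o)) refl m (occ e w)))
               (∑-*ˡ (words m n) (m * m) _))
             (∑const-words n (n * n)) ⟩
      m * m * S₂ n + m ^ n * (n * n) ∎

-- Markov's inequality and the pigeonhole principle

module _ {P : Pred A 0ℓ} (P? : Decidable P) where

  length-filter-¬ : ∀ xs → length xs ≡ length (filter P? xs) + length (filter (¬? ∘ P?) xs)
  length-filter-¬ [] = refl
  length-filter-¬ (x ∷ xs) with P? x
  ... | yes _ = cong suc (length-filter-¬ xs)
  ... | no  _ = trans (cong suc (length-filter-¬ xs)) (sym (+-suc _ _))

  length-*-≤ : ∀ {f : A → ℕ} {c} → (∀ x → ¬ P x → c ≤ f x) → ∀ xs →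
    length xs * c ≤ length (filter P? xs) * c + ∑ xs f
  length-*-≤ c≤f [] = z≤n
  length-*-≤ {f} {c} c≤f (x ∷ xs) with P? x
  ... | yes _ = begin
    c + length xs * c                               ≤⟨ +-monoʳ-≤ c (length-*-≤ c≤f xs) ⟩
    c + (length (filter P? xs) * c + ∑ xs f)        ≡⟨ +-assoc c _ _ ⟨
    c + length (filter P? xs) * c + ∑ xs f          ≤⟨ +-monoʳ-≤ _ (m≤n+m (∑ xs f) (f x)) ⟩
    c + length (filter P? xs) * c + (f x + ∑ xs f)  ∎
    where open ≤-Reasoning
  ... | no ¬p = begin
    c + length xs * c                               ≤⟨ +-mono-≤ (c≤f x ¬p) (length-*-≤ c≤f xs) ⟩
    f x + (length (filter P? xs) * c + ∑ xs f)      ≡⟨ x∙yz≈y∙xz (f x) (length (filter P? xs) * c) (∑ xs f) ⟩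
    length (filter P? xs) * c + (f x + ∑ xs f)      ∎
    where
    open ≤-Reasoning
    open import Algebra.Properties.CommutativeSemigroup +-commutativeSemigroup using (x∙yz≈y∙xz)

markov : ∀ (f : A → ℕ) μ xs → ∑ xs f ≤ length xs * μ →
         length xs ≤ 2 * length (filter (λ x → f x ≤? 2 * μ) xs)
markov {A} f μ xs ∑≤ = +-cancelʳ-≤ L L (2 * G) (*-cancelʳ-≤ (L + L) (2 * G + L) (suc (2 * μ)) (begin
  -- A natural number exceeding `2 * μ` is at least `suc (2 * μ)`, and this factor can be cancelled
  -- even if `μ` is 0.
  (L + L) * suc (2 * μ)
    ≡⟨ solve 2 (λ l t → (l :+ l) :* t := con 2 :* (l :* t)) refl L (suc (2 * μ)) ⟩
  2 * (L * suc (2 * μ))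
    ≤⟨ *-monoʳ-≤ 2 (≤-trans (length-*-≤ small? (λ _ → ≰⇒>) xs) (+-monoʳ-≤ (G * suc (2 * μ)) ∑≤)) ⟩
  2 * (G * suc (2 * μ) + L * μ)
    ≡⟨ solve 3 (λ g l u → con 2 :* (g :* (con 1 :+ con 2 :* u) :+ l :* u)
         := con 2 :* g :* (con 1 :+ con 2 :* u) :+ l :* (con 2 :* u)) refl G L μ ⟩
  2 * G * suc (2 * μ) + L * (2 * μ)
    ≤⟨ +-monoʳ-≤ (2 * G * suc (2 * μ)) (*-monoʳ-≤ L (n≤1+n (2 * μ))) ⟩
  2 * G * suc (2 * μ) + L * suc (2 * μ)
    ≡⟨ *-distribʳ-+ (suc (2 * μ)) (2 * G) L ⟨
  (2 * G + L) * suc (2 * μ) ∎))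
  where
  open ≤-Reasoning
  open +-*-Solver
  small? : Decidable (λ (x : A) → f x ≤ 2 * μ)
  small? x = f x ≤? 2 * μ
  L = length xs
  G = length (filter small? xs)
-- Induction on the number `R` of possible values: remove the elements with the top value `lo + R`,
-- find a frequent value among the rest, and keep whichever of the two is more frequent in `xs`.
pigeonhole : ∀ (f : A → ℕ) lo R {xs} → All (λ x → lo ≤ f x × f x < lo + R) xs →
  ∃[ v ] length xs ≤ R * length (filter (λ x → f x ℕ.≟ v) xs)
pigeonhole f lo zero    []                  = 0 , z≤n
pigeonhole f lo zero    ((lo≤ , <lo) ∷ _)   =
  contradiction (≤-<-trans lo≤ <lo) (λ lt → <⇒≢ lt (sym (+-identityʳ lo)))
pigeonhole {A} f lo (suc R) {xs} in-range = choose (≤-total (c v) (c v₀))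
  where
  v₀ = lo + R
  is? : ∀ u → Decidable (λ (x : A) → f x ≡ u)
  is? u x = f x ℕ.≟ u
  c : ℕ → ℕ
  c u = length (filter (is? u) xs)
  ys = filter (¬? ∘ is? v₀) xs
  in-range′ : All (λ x → lo ≤ f x × f x < lo + R) ys
  in-range′ = All.zipWith
    (λ {x} ((lo≤ , <hi) , ≢v₀) → lo≤ ,
      ≤∧≢⇒< (s≤s⁻¹ (subst (f x <_) (+-suc lo R) <hi)) ≢v₀)
    (All.filter⁺ (¬? ∘ is? v₀) in-range , All.all-filter (¬? ∘ is? v₀) xs)
  v = proj₁ (pigeonhole f lo R in-range′)
  ys≤ : length ys ≤ R * c v
  ys≤ = ≤-trans (proj₂ (pigeonhole f lo R in-range′))
    (*-monoʳ-≤ R (Sublist.length-mono-≤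
      (Sublist.filter⁺ (is? v) (is? v) (λ {refl p → p}) (Sublist.filter-⊆ (¬? ∘ is? v₀) xs))))
  choose : _ → ∃[ u ] length xs ≤ suc R * c u
  choose (inj₁ cv≤) = v₀ , ≤-trans (≤-reflexive (length-filter-¬ (is? v₀) xs))
    (+-monoʳ-≤ (c v₀) (≤-trans ys≤ (*-monoʳ-≤ R cv≤)))
  choose (inj₂ ≤cv) = v , ≤-trans (≤-reflexive (length-filter-¬ (is? v₀) xs))
    (+-mono-≤ ≤cv ys≤)

pigeonholes : ∀ {k} (f : Fin k → A → ℕ) lo R {xs} →
  (∀ j → All (λ x → lo ≤ f j x × f j x < lo + R) xs) →
  Σ[ τ ∈ (Fin k → ℕ) ] ∃[ ys ] ys ⊆ xs × length xs ≤ R ^ k * length ys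
                 × (∀ j → All (λ y → f j y ≡ τ j) ys)
pigeonholes {k = zero}  f lo R {xs} _ =
  (λ ()) , xs , ⊆-refl , ≤-reflexive (sym (+-identityʳ _)) , λ ()
pigeonholes {k = suc k} f lo R {xs} in-range
  with v , xs≤ ← pigeonhole (f zero) lo R (in-range zero)
  with τ , zs , zs⊆ys , ys≤ , const ← pigeonholes (f ∘ suc) lo R
         (λ j → All.filter⁺ (λ x → f zero x ℕ.≟ v) (in-range (suc j)))
  = (λ { zero → v ; (suc j) → τ j }) , zs
  , ⊆-trans zs⊆ys (Sublist.filter-⊆ _ xs)
  , ≤-trans xs≤ (≤-trans (*-monoʳ-≤ R ys≤) (≤-reflexive (sym (*-assoc R (R ^ k) _))))
  , λ { zero    → Sublist.All-resp-⊆ zs⊆ys (All.all-filter (λ x → f zero x ℕ.≟ v) xs)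
      ; (suc j) → const j }

square-cancel-≤ : ∀ {a b} → a * a ≤ b * b → a ≤ b
square-cancel-≤ a²≤b² = ≮⇒≥ λ b<a → <⇒≱ (*-mono-< b<a b<a) a²≤b²

n≤n*n : ∀ n → n ≤ n * n
n≤n*n zero    = z≤n
n≤n*n (suc n) = m≤m*n (suc n) (suc n)

^-distribʳ-* : ∀ a b k → (a * b) ^ k ≡ a ^ k * b ^ k
^-distribʳ-* a b zero    = refl
^-distribʳ-* a b (suc k) = trans (cong (a * b *_) (^-distribʳ-* a b k))
  (solve 4 (λ a b x y → a :* b :* (x :* y) := a :* x :* (b :* y)) refl a b (a ^ k) (b ^ k))
  where open +-*-Solver

Unique-resp-⊆ : ∀ {xs ys : List A} → xs ⊆ ys → Unique ys → Unique xs
Unique-resp-⊆ []           []          = []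
Unique-resp-⊆ (y ∷ʳ τ)     (_ ∷ ys!)   = Unique-resp-⊆ τ ys!
Unique-resp-⊆ (refl ∷ τ)   (y∉ ∷ ys!)  = Sublist.All-resp-⊆ τ y∉ ∷ Unique-resp-⊆ τ ys!

⌊√_⌋ : ℕ → ℕ
⌊√ n ⌋ = rootFloor 2 n 1

⌊√n⌋²≤n : ∀ n → ⌊√ n ⌋ * ⌊√ n ⌋ ≤ n
⌊√n⌋²≤n n = subst₂ _≤_ (cong (⌊√ n ⌋ *_) (*-identityʳ ⌊√ n ⌋)) (*-identityʳ n)
  (rootFloor-lower 2 n 1)

⌊√n⌋≥1 : ∀ n .{{_ : NonZero n}} → 1 ≤ ⌊√ n ⌋
⌊√n⌋≥1 n = rootFloor-max 2 n 1 (subst (1 ≤_) (sym (*-identityʳ n)) (>-nonZero⁻¹ n))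

n≤4⌊√n⌋² : ∀ n .{{_ : NonZero n}} → n ≤ 4 * (⌊√ n ⌋ * ⌊√ n ⌋)
n≤4⌊√n⌋² n = begin
  n                                  ≤⟨ <⇒≤ (subst₂ _<_ (*-identityʳ n)
                                          (cong (suc s *_) (*-identityʳ (suc s)))
                                          (rootFloor-upper 2 n 1)) ⟩
  suc s * suc s                      ≤⟨ *-mono-≤ (+-monoˡ-≤ s (⌊√n⌋≥1 n)) (+-monoˡ-≤ s (⌊√n⌋≥1 n)) ⟩
  (s + s) * (s + s)                  ≡⟨ solve 1 (λ s → (s :+ s) :* (s :+ s) := con 4 :* (s :* s)) refl s ⟩
  4 * (s * s)                        ∎
  where
  open ≤-Reasoning
  open +-*-Solver
  s = ⌊√ n ⌋

-- Large families of words with equal digit counts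

module _ (k : ℕ) where

  private
    m = 2 + k
    -- Markov's threshold 2 k m n is at most 8 k m s² for s = `⌊√ n ⌋`, as n ≤ 4 s². Hence it is at
    -- most c s² ≤ (c s)², and the scaled counts stay within T = c s of n.
    c = 8 * (k * m)

  tail-digit : Fin k → Fin m
  tail-digit j = suc (suc j)

  -- The 2 is lost to Markov; each of the `k` pigeonhole steps has a window of 2 T + 1 ≤ (2 c + 1) s
  -- values.
  lossFactor : ℕ
  lossFactor = 2 * suc (2 * c) ^ k

  lossFactor≢0 : NonZero lossFactor
  lossFactor≢0 = m*n≢0 2 (suc (2 * c) ^ k) {{it}} {{m^n≢0 (suc (2 * c)) k}}

  -- Markov is applied once, to the sum of the deviations of all `k` digits, so that half of the
  -- words are concentrated in every prescribed digit simultaneously. The pigeonholes then act on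
  -- the counts multiplied by `m`.
  large-balanced-family : ∀ n .{{_ : NonZero n}} →
    ∃[ ws ] Unique ws
    × (∀ {v w : Word m n} → v ∈ ws → w ∈ ws → ∀ j → occ (tail-digit j) v ≡ occ (tail-digit j) w)
    × m ^ n ≤ lossFactor * ⌊√ n ⌋ ^ k * length ws
  large-balanced-family n =
    let τ , ws , ws⊆good , good≤ , const = pigeonholes
          (λ j w → m * occ (tail-digit j) w) (n ∸ T) (suc (2 * T)) {good}
          (λ j → All.map (λ {w} → concentrated j w) (All.all-filter (λ w → total w ≤? 2 * (k * (m * n))) (words m n)))
    in ws
    , Unique-resp-⊆ ws⊆good (Unique.filter⁺ _ (words-unique m n))
    , (λ v∈ w∈ j → *-cancelˡ-≡ _ _ m
         (trans (All.lookup (const j) v∈) (sym (All.lookup (const j) w∈))))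
    , size ws good≤
    where
    s = ⌊√ n ⌋
    T = c * s
    total : Word m n → ℕ
    total w = ∑[ j ∈ allFin k ] deviation (tail-digit j) w
    good = filter (λ w → total w ≤? 2 * (k * (m * n))) (words m n)

    distance≤ : ∀ j (w : Word m n) → total w ≤ 2 * (k * (m * n)) →
                ∣ m * occ (tail-digit j) w - n ∣ ≤ T
    distance≤ j w total≤ = square-cancel-≤ (begin
      deviation (tail-digit j) w         ≤⟨ term≤∑ (λ j → deviation (tail-digit j) w) j ⟩
      total w                            ≤⟨ total≤ ⟩
      2 * (k * (m * n))                  ≤⟨ *-monoʳ-≤ 2 (*-monoʳ-≤ k (*-monoʳ-≤ m (n≤4⌊√n⌋² n))) ⟩
      2 * (k * (m * (4 * (s * s))))      ≡⟨ solve 3 (λ k m s → con 2 :* (k :* (m :* (con 4 :* (s :* s))))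
                                              := con 8 :* (k :* m) :* (s :* s)) refl k m s ⟩
      c * (s * s)                        ≤⟨ *-monoˡ-≤ (s * s) (n≤n*n c) ⟩
      c * c * (s * s)                    ≡⟨ solve 2 (λ c s → c :* c :* (s :* s) := c :* s :* (c :* s))
                                              refl c s ⟩
      T * T                              ∎)
      where
      open ≤-Reasoning
      open +-*-Solver

    concentrated : ∀ j (w : Word m n) → total w ≤ 2 * (k * (m * n)) →
      n ∸ T ≤ m * occ (tail-digit j) w × m * occ (tail-digit j) w < n ∸ T + suc (2 * T)
    concentrated j w total≤ =
        m≤n+o⇒m∸n≤o n T (begin
          n                     ≤⟨ m≤n+∣n-m∣ n x ⟩
          x + ∣ x - n ∣         ≤⟨ +-monoʳ-≤ x (distance≤ j w total≤) ⟩
          x + T                 ≡⟨ +-comm x T ⟩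
          T + x                 ∎)
      , (begin-strict
          x                     ≤⟨ m≤n+∣m-n∣ x n ⟩
          -- `n ∸ T` may be truncated to 0; `n ≤ T + (n ∸ T)` holds in either case.
          n + ∣ x - n ∣         ≤⟨ +-mono-≤ (m≤n+m∸n n T) (distance≤ j w total≤) ⟩
          T + (n ∸ T) + T       ≡⟨ solve 2 (λ t r → t :+ r :+ t := r :+ con 2 :* t) refl T (n ∸ T) ⟩
          n ∸ T + 2 * T         <⟨ +-monoʳ-< (n ∸ T) (n<1+n (2 * T)) ⟩
          n ∸ T + suc (2 * T)   ∎)
      where
      open ≤-Reasoning
      open +-*-Solver
      x = m * occ (tail-digit j) w

    ∑-total : ∑ (words m n) total ≤ length (words m n) * (k * (m * n))
    ∑-total = begin
      ∑ (words m n) total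
        ≡⟨ ∑-swap (words m n) (allFin k) (λ w j → deviation (tail-digit j) w) ⟩
      ∑[ j ∈ allFin k ] ∑ (words m n) (deviation (tail-digit j))
        ≤⟨ ∑-mono-≤ (allFin k) (λ j → ∑-deviation (tail-digit j) n) ⟩
      ∑[ _ ∈ allFin k ] (m ^ n * (m * n))
        ≡⟨ trans (∑-const (allFin k) _) (cong (_* (m ^ n * (m * n))) (length-tabulate {n = k} (λ i → i))) ⟩
      k * (m ^ n * (m * n))
        ≡⟨ solve 3 (λ k p q → k :* (p :* q) := p :* (k :* q)) refl k (m ^ n) (m * n) ⟩
      m ^ n * (k * (m * n))
        ≡⟨ cong (_* (k * (m * n))) (length-words m n) ⟨
      length (words m n) * (k * (m * n)) ∎
      where
      open ≤-Reasoning
      open +-*-Solver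

    size : ∀ (ws : List (Word m n)) → length good ≤ suc (2 * T) ^ k * length ws →
           m ^ n ≤ lossFactor * s ^ k * length ws
    size ws good≤ = begin
      m ^ n                                   ≡⟨ length-words m n ⟨
      length (words m n)                      ≤⟨ markov total (k * (m * n)) (words m n) ∑-total ⟩
      2 * length good                         ≤⟨ *-monoʳ-≤ 2 good≤ ⟩
      2 * (suc (2 * T) ^ k * length ws)       ≤⟨ *-monoʳ-≤ 2 (*-monoˡ-≤ (length ws) (^-monoˡ-≤ k range≤)) ⟩
      2 * ((suc (2 * c) * s) ^ k * length ws) ≡⟨ cong (λ r → 2 * (r * length ws)) (^-distribʳ-* (suc (2 * c)) s k) ⟩
      2 * (suc (2 * c) ^ k * s ^ k * length ws)
        ≡⟨ solve 3 (λ a b l → con 2 :* (a :* b :* l) := con 2 :* a :* b :* l)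
             refl (suc (2 * c) ^ k) (s ^ k) (length ws) ⟩
      lossFactor * s ^ k * length ws          ∎
      where
      open ≤-Reasoning
      open +-*-Solver
      range≤ : suc (2 * T) ≤ suc (2 * c) * s
      range≤ = +-mono-≤ (⌊√n⌋≥1 n) (≤-reflexive (sym (*-assoc 2 c s)))

  -- A weight depends only on the tail counts and on the joint count `head` of the first two digits.
  -- Splitting the constant weight `one` in the same way shows that `head` is n minus the sum of the
  -- tail counts, so it agrees too.
  weight-balanced : ∀ {n} (f : Fin m → ℕ) → f zero ≡ f (suc zero) → (v w : Word m n) →
    (∀ j → occ (tail-digit j) v ≡ occ (tail-digit j) w) → weight f v ≡ weight f w
  weight-balanced f f₀≡f₁ v w same = trans (split f f₀≡f₁ v)
    (trans (cong₂ (λ a b → f zero * a + b) head≡ (tail≡ f)) (sym (split f f₀≡f₁ w)))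
    where
    open +-*-Solver
    head : ∀ {n} → Word m n → ℕ
    head w = occ zero w + occ (suc zero) w
    tail : ∀ {n} → (Fin m → ℕ) → Word m n → ℕ
    tail f w = ∑[ j ∈ allFin k ] (f (tail-digit j) * occ (tail-digit j) w)
    tail≡ : ∀ f → tail f v ≡ tail f w
    tail≡ f = ∑-cong (allFin k) (λ j → cong (f (tail-digit j) *_) (same j))
    split : ∀ {n} f → f zero ≡ f (suc zero) → (w : Word m n) →
            weight f w ≡ f zero * head w + tail f w
    split f f₀≡f₁ w = trans (weight≡∑occ f w) (trans (∑-allFin-suc (λ e → f e * occ e w))
      (trans (cong (f zero * occ zero w +_) (trans (∑-allFin-suc (λ e → f (suc e) * occ (suc e) w))
               (cong (λ a → a * occ (suc zero) w + tail f w) (sym f₀≡f₁))))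
        (solve 4 (λ a x y t → a :* x :+ (a :* y :+ t) := a :* (x :+ y) :+ t)
          refl (f zero) (occ zero w) (occ (suc zero) w) (tail f w))))
    one : Fin m → ℕ
    one _ = 1
    weight-one : ∀ {n} (w : Word m n) → weight one w ≡ n
    weight-one []      = refl
    weight-one (_ ∷ w) = cong suc (weight-one w)
    head+tail : ∀ {n} (w : Word m n) → head w + tail one w ≡ n
    head+tail w = trans (cong (_+ tail one w) (sym (*-identityˡ (head w))))
      (trans (sym (split one refl w)) (weight-one w))
    head≡ : head v ≡ head w
    head≡ = +-cancelʳ-≡ (tail one w) (head v) (head w)
      (trans (cong (head v +_) (sym (tail≡ one))) (trans (head+tail v) (sym (head+tail w))))

-- Caps from separated digit sets

record Design (p k : ℕ) : Set where
  field
    digits  : Vec ℕ (2 + k)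
    weights : List (Vec ℕ (1 + k) × Vec ℕ (1 + k) × Vec ℕ (1 + k))

-- Weights are listed by class: the first two digits form a single class.
class : ∀ {k} → Fin (2 + k) → Fin (1 + k)
class zero    = zero
class (suc d) = d

-- Permuting the three points of a line acts on its ratio t with orbits of size
-- at most six, so one triple of weights serves a whole orbit.
orderings : ∀ {A : Set} → A × A × A → List (A × A × A)
orderings (a , b , c) =
  (a , b , c) ∷ (a , c , b) ∷ (b , a , c) ∷ (b , c , a) ∷ (c , a , b) ∷ (c , b , a) ∷ []

module _ {p k : ℕ} .{{_ : NonZero p}} (D : Design p k) where

  open Design D

  Digit : Set
  Digit = Fin (2 + k)

  digit : Digit → ℕ
  digit = lookup digits

  -- The residue y with y - x = t (x - z), where `p ∸ digit z` stands for -z: the remaining point of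
  -- the line with ratio t through x and z.
  third : ℕ → Digit → Digit → ℕ
  third t x z = (digit x + t * (digit x + (p ∸ digit z))) % p

  -- Taking v as an argument shares the evaluation of third between all y.
  line : Digit → Digit → ℕ → List (Digit × Digit × Digit)
  line x z v = map (λ y → x , y , z) (filter (λ y → digit y ℕ.≟ v) (allFin (2 + k)))

  lines : ℕ → List (Digit × Digit × Digit)
  lines t = concatMap (λ (x , z) → line x z (third t x z))
    (cartesianProduct (allFin (2 + k)) (allFin (2 + k)))

  -- For t other than 0 and -1 over a field, two coinciding points of a line coincide with the
  -- third. So a single repeated digit is the only degenerate line, and there `Constant` gives
  -- equality.
  Separates : (f g h : Digit → ℕ) → Digit × Digit × Digit → Set
  Separates f g h (x , y , z) =
    (x ≡ y × y ≡ z) ⊎ f zero + g zero + h zero < f x + g y + h z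

  digitWeight : Vec ℕ (1 + k) → Digit → ℕ
  digitWeight v d = lookup v (class d)

  Constant : (f g h : Digit → ℕ) → Set
  Constant f g h = ∀ d → f d + g d + h d ≡ f zero + g zero + h zero

  -- The first two cases are the ratios 0 and −1, at which two of the points of a
  -- line coincide.
  Spread : List (Digit × Digit × Digit) → Set
  Spread ls =
    All (λ (x , y , z) → x ≡ y) ls ⊎
    All (λ (x , y , z) → y ≡ z) ls ⊎
    Any (λ (f , g , h) → All (Separates (digitWeight f) (digitWeight g) (digitWeight h)) ls
                         × Constant (digitWeight f) (digitWeight g) (digitWeight h))
      (concatMap orderings weights)

  record IsValid : Set where
    field
      digit<p   : ∀ d → digit d < p
      injective : ∀ d e → digit d ≡ digit e → d ≡ e
      -- The primality of p enters in this form: nonzero residues are invertible.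
      invert    : ∀ (a : Fin p) → toℕ a ≡ 0 ⊎ (∃[ b ] (toℕ {p} b * toℕ a) % p ≡ 1)
      spread    : ∀ (t : Fin p) → Spread (lines (toℕ t))

  separates? : ∀ f g h l → Dec (Separates f g h l)
  separates? f g h (x , y , z) =
    (x ≟ y ×-dec y ≟ z) ⊎-dec (f zero + g zero + h zero <? f x + g y + h z)

  spread? : ∀ ls → Dec (Spread ls)
  spread? ls =
    All.all? (λ (x , y , z) → x ≟ y) ls ⊎-dec
    All.all? (λ (x , y , z) → y ≟ z) ls ⊎-dec
    Any.any? (λ (f , g , h) →
        All.all? (separates? (digitWeight f) (digitWeight g) (digitWeight h)) ls
        ×-dec all? λ d → _ ℕ.≟ _)
      (concatMap orderings weights)

  isValid? : Dec IsValid
  isValid? = map′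
    (λ (l , j , i , s) → record { digit<p = l ; injective = j ; invert = i ; spread = s })
    (λ v → IsValid.digit<p v , IsValid.injective v , IsValid.invert v , IsValid.spread v)
    ( (all? λ d → digit d <? p)
      ×-dec (all? λ d → all? λ e → (digit d ℕ.≟ digit e) →-dec (d ≟ e))
      ×-dec (all? λ a → (toℕ a ℕ.≟ 0) ⊎-dec any? λ b → (toℕ b * toℕ a) % p ℕ.≟ 1)
      ×-dec (all? λ t → spread? (lines (toℕ t))) )

subset : ∀ {N} → List (Fin N) → Subset N
subset []       = ∅
subset (x ∷ xs) = ⁅ x ⁆ ∪ subset xs

∈-subset⁻ : ∀ {N} (xs : List (Fin N)) {y} → y ∈ₛ subset xs → y ∈ xs
∈-subset⁻ []       y∈ = ⊥-elim (∉⊥ y∈)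
∈-subset⁻ (x ∷ xs) y∈ with x∈p∪q⁻ ⁅ x ⁆ (subset xs) y∈
... | inj₁ y∈x  = here (x∈⁅y⁆⇒x≡y x y∈x)
... | inj₂ y∈xs = there (∈-subset⁻ xs y∈xs)

length≤∣subset∣ : ∀ {N} {xs : List (Fin N)} → Unique xs → length xs ≤ ∣ subset xs ∣
length≤∣subset∣ [] = z≤n
length≤∣subset∣ {xs = x ∷ xs} (x∉xs ∷ xs!) = ≤-<-trans (length≤∣subset∣ xs!)
  (p⊂q⇒∣p∣<∣q∣ ( (λ {y} → q⊆p∪q ⁅ x ⁆ (subset xs) {y})
                , x , p⊆p∪q {p = ⁅ x ⁆} (subset xs) (x∈⁅x⁆ x)
                , λ x∈ → All.lookup x∉xs (∈-subset⁻ xs x∈) refl))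

lookup-ext : ∀ {n} {xs ys : Vec A n} → (∀ i → lookup xs i ≡ lookup ys i) → xs ≡ ys
lookup-ext {xs = xs} {ys} eq =
  trans (sym (Vec.tabulate∘lookup xs)) (trans (Vec.tabulate-cong eq) (Vec.tabulate∘lookup ys))

-- Arithmetic modulo p on natural numbers

module Congruence (p : ℕ) .{{_ : NonZero p}} where

  infix 4 _≋_
  _≋_ : ℕ → ℕ → Set
  m ≋ n = m % p ≡ n % p

  ≋-% : ∀ m → m % p ≋ m
  ≋-% m = m%n%n≡m%n m p

  ≋-+ : ∀ {m m′ n n′} → m ≋ m′ → n ≋ n′ → m + n ≋ m′ + n′
  ≋-+ {m} {m′} {n} {n′} m≋ n≋ = trans (%-distribˡ-+ m n p)
    (trans (cong₂ (λ a b → (a + b) % p) m≋ n≋) (sym (%-distribˡ-+ m′ n′ p)))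

  ≋-* : ∀ {m m′ n n′} → m ≋ m′ → n ≋ n′ → m * n ≋ m′ * n′
  ≋-* {m} {m′} {n} {n′} m≋ n≋ = trans (%-distribˡ-* m n p)
    (trans (cong₂ (λ a b → (a * b) % p) m≋ n≋) (sym (%-distribˡ-* m′ n′ p)))

  ≋-p : ∀ m → m + p ≋ m
  ≋-p m = [m+n]%n≡m%n m p

  toℕ-mod : ∀ m → toℕ (m mod p) ≡ m % p
  toℕ-mod m = toℕ-fromℕ< (m%n<n m p)

  -- In ℤ this reads y = x + t (x − z) for y − x + t (z − x) = 0; as
  -- p ∸ x and p ∸ z stand for −x and −z, here z − x and x − z add up to 2p.
  third-point : ∀ {a b e x y z} → e * a ≋ 1 → x ≤ p → z ≤ p →
    a * (y + (p ∸ x)) + b * (z + (p ∸ x)) ≋ 0 →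
    y ≋ x + e * b % p * (x + (p ∸ z))
  third-point {a} {b} {e} {x} {y} {z} ea≋1 x≤p z≤p ab≋0 = begin
    y % p                          ≡⟨ ≋-p y ⟨
    (y + p) % p                    ≡⟨ cong (_% p) y+p ⟩
    (U + x) % p                    ≡⟨ cong (_% p) (+-identityʳ (U + x)) ⟨
    (U + x + 0) % p                ≡⟨ ≋-+ {U + x} refl t[V+W]≋0 ⟨
    (U + x + t * (V + W)) % p      ≡⟨ cong (_% p) (solve 5 (λ u x t v w →
                                        u :+ x :+ t :* (v :+ w) := (u :+ t :* v) :+ (x :+ t :* w))
                                        refl U x t V W) ⟩
    (U + t * V + (x + t * W)) % p  ≡⟨ ≋-+ {U + t * V} {0} U+tV≋0 refl ⟩
    (x + t * W) % p                ∎
    where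
    open ≡-Reasoning
    open +-*-Solver
    U = y + (p ∸ x)
    V = z + (p ∸ x)
    W = x + (p ∸ z)
    t = e * b % p
    y+p : y + p ≡ U + x
    y+p = trans (cong (y +_) (sym (m∸n+n≡m x≤p))) (sym (+-assoc y (p ∸ x) x))
    V+W : V + W ≡ p + p
    V+W = trans (solve 4 (λ x x′ z z′ → (z :+ x′) :+ (x :+ z′) := (x′ :+ x) :+ (z′ :+ z))
                  refl x (p ∸ x) z (p ∸ z))
            (cong₂ _+_ (m∸n+n≡m x≤p) (m∸n+n≡m z≤p))
    t[V+W]≋0 : t * (V + W) ≋ 0
    t[V+W]≋0 = trans (≋-* {t} refl (trans (cong (_% p) V+W) (trans (≋-p p) (≋-p 0))))
      (cong (_% p) (*-zeroʳ t))
    U+tV≋0 : U + t * V ≋ 0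
    U+tV≋0 = begin
      (U + t * V) % p                ≡⟨ ≋-+ {U} (trans (cong (_% p) (sym (*-identityˡ U)))
                                          (≋-* {1} {e * a} (sym ea≋1) refl))
                                          (≋-* {t} {e * b} (≋-% (e * b)) refl) ⟩
      (e * a * U + e * b * V) % p    ≡⟨ cong (_% p) (solve 5 (λ e a b u v →
                                          e :* a :* u :+ e :* b :* v := e :* (a :* u :+ b :* v))
                                          refl e a b U V) ⟩
      (e * (a * U + b * V)) % p      ≡⟨ ≋-* {e} refl ab≋0 ⟩
      (e * 0) % p                    ≡⟨ cong (_% p) (*-zeroʳ e) ⟩
      0 % p                          ∎

-- The cap defined by a valid design

module _ {p k : ℕ} .{{_ : NonZero p}} (D : Design p k) (valid : IsValid D) where

  open Residues p
  open Congruence p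
  open IsValid valid

  private
    m = 2 + k

  digitₚ : Digit D → Fin p
  digitₚ d = digit D d mod p

  toℕ-digitₚ : ∀ d → toℕ (digitₚ d) ≡ digit D d
  toℕ-digitₚ d = trans (toℕ-mod (digit D d)) (m<n⇒m%n≡m (digit<p d))

  toℕ≡0⇒≡0ₚ : ∀ {a} → toℕ a ≡ 0 → a ≡ 0ₚ
  toℕ≡0⇒≡0ₚ a≡0 = toℕ-injective (trans a≡0 (sym (trans (toℕ-mod 0) (m*n%n≡0 0 p))))

  ∈-lines⁺ : ∀ t {x y z} → digit D y ≡ third D t x z → (x , y , z) ∈ lines D t
  ∈-lines⁺ t {x} {y} {z} eq = ∈-concatMap⁺ (λ (x , z) → line D x z (third D t x z))
    (Any.map (λ { refl → ∈-map⁺ (λ y → x , y , z)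
                   (∈-filter⁺ (λ y → digit D y ℕ.≟ third D t x z) (∈-allFin y) eq) })
      (∈-cartesianProduct⁺ (∈-allFin x) (∈-allFin z)))

  combination≋0 : ∀ a b x y z →
    a *ₚ (digitₚ y -ₚ digitₚ x) +ₚ b *ₚ (digitₚ z -ₚ digitₚ x) ≡ 0ₚ →
    toℕ a * (digit D y + (p ∸ digit D x)) + toℕ b * (digit D z + (p ∸ digit D x)) ≋ 0
  combination≋0 a b x y z eq = begin
    (toℕ a * U + toℕ b * V) % p
      ≡⟨ ≋-+ {toℕ (a *ₚ (digitₚ y -ₚ digitₚ x))} {_} {toℕ (b *ₚ (digitₚ z -ₚ digitₚ x))}
           (term a y) (term b z) ⟨
    (toℕ (a *ₚ (digitₚ y -ₚ digitₚ x)) + toℕ (b *ₚ (digitₚ z -ₚ digitₚ x))) % p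
      ≡⟨ toℕ-mod _ ⟨
    toℕ (a *ₚ (digitₚ y -ₚ digitₚ x) +ₚ b *ₚ (digitₚ z -ₚ digitₚ x))
      ≡⟨ cong toℕ eq ⟩
    toℕ 0ₚ
      ≡⟨ toℕ-mod 0 ⟩
    0 % p ∎
    where
    open ≡-Reasoning
    U = digit D y + (p ∸ digit D x)
    V = digit D z + (p ∸ digit D x)
    term : ∀ a y → toℕ (a *ₚ (digitₚ y -ₚ digitₚ x)) ≋ toℕ a * (digit D y + (p ∸ digit D x))
    term a y = trans (cong (_% p) (toℕ-mod (toℕ a * toℕ (digitₚ y -ₚ digitₚ x))))
      (trans (≋-% _) (≋-* {toℕ a} refl
        (trans (cong (_% p) (toℕ-mod (toℕ (digitₚ y) + (p ∸ toℕ (digitₚ x)))))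
          (trans (≋-% _) (cong₂ (λ u v → (u + (p ∸ v)) % p) (toℕ-digitₚ y) (toℕ-digitₚ x))))))

  -- For words with the same digit counts the two sums agree, so that x = y = z.
  excess : ∀ {n} {f g h : Digit D → ℕ} → Constant D f g h → (x y z : Word m n) →
    (∀ i → Separates D f g h (lookup x i , lookup y i , lookup z i)) →
    (x ≡ y × y ≡ z) ⊎
    weight f z + weight g z + weight h z < weight f x + weight g y + weight h z
  excess const [] [] [] _ = inj₁ (refl , refl)
  excess {f = f} {g} {h} const (d ∷ x) (e ∷ y) (c ∷ z) sep =
    combine (excess const x y z (λ i → sep (suc i))) (sep zero)
    where
    open +-*-Solver
    shuffle : ∀ a b c a′ b′ c′ → (a + a′) + (b + b′) + (c + c′) ≡ (a + b + c) + (a′ + b′ + c′)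
    shuffle = solve 6 (λ a b c a′ b′ c′ →
      (a :+ a′) :+ (b :+ b′) :+ (c :+ c′) := (a :+ b :+ c) :+ (a′ :+ b′ :+ c′)) refl
    -- By `const` the constant C may be read off at the digit `c` of the third word. Over all
    -- coordinates n C thus becomes the total weight of `z` under f, g and h, which can be compared
    -- with the other side weight by weight.
    head< : f zero + g zero + h zero < f d + g e + h c → f c + g c + h c < f d + g e + h c
    head< = subst (_< f d + g e + h c) (sym (const c))
    head≤ : Separates D f g h (d , e , c) → f c + g c + h c ≤ f d + g e + h c
    head≤ (inj₁ (refl , refl)) = ≤-refl
    head≤ (inj₂ lt)            = <⇒≤ (head< lt)
    reassemble : (f c + g c + h c) + (weight f z + weight g z + weight h z) <
                 (f d + g e + h c) + (weight f x + weight g y + weight h z) →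
                 weight f (c ∷ z) + weight g (c ∷ z) + weight h (c ∷ z) <
                 weight f (d ∷ x) + weight g (e ∷ y) + weight h (c ∷ z)
    reassemble = subst₂ _<_
      (sym (shuffle (f c) (g c) (h c) (weight f z) (weight g z) (weight h z)))
      (sym (shuffle (f d) (g e) (h c) (weight f x) (weight g y) (weight h z)))
    combine : _ → Separates D f g h (d , e , c) → _
    combine (inj₂ lt) s = inj₂ (reassemble (+-mono-≤-< (head≤ s) lt))
    combine (inj₁ (refl , refl)) (inj₁ (refl , refl)) = inj₁ (refl , refl)
    combine (inj₁ (refl , refl)) (inj₂ lt) = inj₂ (reassemble (+-mono-<-≤ (head< lt) ≤-refl))

  module _ {n : ℕ} where

    encode : Word m n → Fin (p ^ n)
    encode w = funToFin (λ i → digitₚ (lookup w i))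

    point-encode : ∀ w i → point n p (encode w) i ≡ digitₚ (lookup w i)
    point-encode w = finToFun-funToFin (λ i → digitₚ (lookup w i))

    encode-injective : ∀ {v w} → encode v ≡ encode w → v ≡ w
    encode-injective {v} {w} eq = lookup-ext λ i → injective _ _ (begin
      digit D (lookup v i)           ≡⟨ toℕ-digitₚ (lookup v i) ⟨
      toℕ (digitₚ (lookup v i))      ≡⟨ cong toℕ (point-encode v i) ⟨
      toℕ (point n p (encode v) i)   ≡⟨ cong (λ x → toℕ (point n p x i)) eq ⟩
      toℕ (point n p (encode w) i)   ≡⟨ cong toℕ (point-encode w i) ⟩
      toℕ (digitₚ (lookup w i))      ≡⟨ toℕ-digitₚ (lookup w i) ⟩
      digit D (lookup w i)           ∎)
      where open ≡-Reasoning

    encoded-combination≋0 : ∀ a b u v w →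
      (∀ i → a *ₚ _⟶⟨_⟩ n p (encode u) (encode v) i +ₚ
             b *ₚ _⟶⟨_⟩ n p (encode u) (encode w) i ≡ 0ₚ) →
      ∀ i → toℕ a * (digit D (lookup v i) + (p ∸ digit D (lookup u i))) +
            toℕ b * (digit D (lookup w i) + (p ∸ digit D (lookup u i))) ≋ 0
    encoded-combination≋0 a b u v w dep i =
      combination≋0 a b (lookup u i) (lookup v i) (lookup w i)
        (trans (sym (cong₂ (λ q r → a *ₚ q +ₚ b *ₚ r)
          (cong₂ _-ₚ_ (point-encode v i) (point-encode u i))
          (cong₂ _-ₚ_ (point-encode w i) (point-encode u i)))) (dep i))

  module _ {n : ℕ} {ws : List (Word m n)}
    (balanced : ∀ {v w} → v ∈ ws → w ∈ ws → ∀ j → occ (tail-digit k j) v ≡ occ (tail-digit k j) w)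
    where

    -- In the first two cases of `Spread` a coincidence holds digit by digit. In the third, distinct
    -- words would have a strict excess, but balanced counts give x and z the same weight under f,
    -- and y and z the same under g.
    degenerate : ∀ {ls x y z} → Spread D ls → x ∈ ws → y ∈ ws → z ∈ ws →
      (∀ i → (lookup x i , lookup y i , lookup z i) ∈ ls) → x ≡ y ⊎ y ≡ z
    degenerate (inj₁ x≡y) _ _ _ on = inj₁ (lookup-ext λ i → All.lookup x≡y (on i))
    degenerate (inj₂ (inj₁ y≡z)) _ _ _ on = inj₂ (lookup-ext λ i → All.lookup y≡z (on i))
    degenerate {x = x} {y} {z} (inj₂ (inj₂ separated)) x∈ y∈ z∈ on
      with (f , g , h) , sep , const ← Any.satisfied separated
      with excess const x y z (λ i → All.lookup sep (on i))
    ... | inj₁ (x≡y , _) = inj₁ x≡y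
    ... | inj₂ lt = ⊥-elim (<-irrefl
      (cong₂ (λ a b → a + b + weight (digitWeight D h) z)
        (weight-balanced k (digitWeight D f) refl z x (balanced z∈ x∈))
        (weight-balanced k (digitWeight D g) refl z y (balanced z∈ y∈))) lt)

    -- Multiplying by the inverse of `a` puts every coordinate on a line with the one ratio t = b /
    -- a, so a single instance of `spread` covers all of them.
    dependent⇒equal : ∀ {a b : Fin p} {x y z} → x ∈ ws → y ∈ ws → z ∈ ws → toℕ a ≢ 0 →
      (∀ i → toℕ a * (digit D (lookup y i) + (p ∸ digit D (lookup x i))) +
             toℕ b * (digit D (lookup z i) + (p ∸ digit D (lookup x i))) ≋ 0) →
      x ≡ y ⊎ y ≡ z
    dependent⇒equal {a} {b} {x} {y} {z} x∈ y∈ z∈ a≢0 dep with invert a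
    ... | inj₁ a≡0 = contradiction a≡0 a≢0
    ... | inj₂ (e , ea≡1) = degenerate (spread t) x∈ y∈ z∈ λ i → ∈-lines⁺ (toℕ t) (begin
      digit D (lookup y i)
        ≡⟨ m<n⇒m%n≡m (digit<p (lookup y i)) ⟨
      digit D (lookup y i) % p
        ≡⟨ third-point {toℕ a} {toℕ b} {toℕ e} ea≡1′
             (<⇒≤ (digit<p (lookup x i))) (<⇒≤ (digit<p (lookup z i))) (dep i) ⟩
      (digit D (lookup x i) + toℕ e * toℕ b % p * (digit D (lookup x i) + (p ∸ digit D (lookup z i)))) % p
        ≡⟨ cong (λ s → (digit D (lookup x i) + s * (digit D (lookup x i) + (p ∸ digit D (lookup z i)))) % p)
             (toℕ-mod (toℕ e * toℕ b)) ⟨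
      third D (toℕ t) (lookup x i) (lookup z i) ∎)
      where
      open ≡-Reasoning
      t = (toℕ e * toℕ b) mod p
      ea≡1′ : toℕ e * toℕ a ≋ 1
      ea≡1′ = trans (sym (≋-% (toℕ e * toℕ a))) (cong (_% p) ea≡1)

    subset-isCap : IsCap n p (subset (map encode ws))
    subset-isCap x y z x∈ y∈ z∈ x≢y x≢z y≢z a b dep
      with u , u∈ , refl ← ∈-map⁻ encode (∈-subset⁻ (map encode ws) x∈)
      with v , v∈ , refl ← ∈-map⁻ encode (∈-subset⁻ (map encode ws) y∈)
      with w , w∈ , refl ← ∈-map⁻ encode (∈-subset⁻ (map encode ws) z∈)
      with toℕ a ℕ.≟ 0 | toℕ b ℕ.≟ 0
    ... | yes a≡0 | yes b≡0 = toℕ≡0⇒≡0ₚ a≡0 , toℕ≡0⇒≡0ₚ b≡0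
    ... | no a≢0 | _ = ⊥-elim (distinct
        (dependent⇒equal {a} {b} u∈ v∈ w∈ a≢0 (encoded-combination≋0 a b u v w dep)))
      where
      distinct : ¬ (u ≡ v ⊎ v ≡ w)
      distinct (inj₁ refl) = x≢y refl
      distinct (inj₂ refl) = y≢z refl
    -- Here a = 0 cannot be inverted; the dependency is read with the second and third points
    -- exchanged, so that `b` is the coefficient to invert.
    ... | yes _ | no b≢0 = ⊥-elim (distinct
        (dependent⇒equal {b} {a} u∈ w∈ v∈ b≢0 λ i → trans
          (cong (_% p) (+-comm
            (toℕ b * (digit D (lookup w i) + (p ∸ digit D (lookup u i))))
            (toℕ a * (digit D (lookup v i) + (p ∸ digit D (lookup u i))))))
          (encoded-combination≋0 a b u v w dep i)))
      where
      distinct : ¬ (u ≡ w ⊎ w ≡ v)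
      distinct (inj₁ refl) = x≢z refl
      distinct (inj₂ refl) = y≢z refl

  m^n≤maxCapSize : ∀ n .{{_ : NonZero n}} →
    m ^ n ≤ lossFactor k * ⌊√ n ⌋ ^ k * maxCapSize n p
  m^n≤maxCapSize n =
    let ws , ws! , balanced , m^n≤ = large-balanced-family k n
    in ≤-trans m^n≤ (*-monoʳ-≤ (lossFactor k * ⌊√ n ⌋ ^ k) (≤-trans
         (≤-reflexive (sym (length-map encode ws)))
         (≤-trans (length≤∣subset∣ (Unique.map⁺ encode-injective ws!))
           (maxCapSize-max n p (subset (map encode ws)) (subset-isCap balanced)))))

-- Growth rates

-- Bernoulli's inequality (1 + 1/Q)^t ≥ 1 + t/Q, multiplied by Q · Q^t.
bernoulli : ∀ Q t → (Q + t) * Q ^ t ≤ Q * suc Q ^ t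
bernoulli Q zero    = ≤-reflexive (cong (_* 1) (+-identityʳ Q))
bernoulli Q (suc t) = begin
  (Q + suc t) * (Q * Q ^ t)        ≤⟨ m≤m+n _ (t * Q ^ t) ⟩
  (Q + suc t) * (Q * Q ^ t) + t * Q ^ t
    ≡⟨ solve 3 (λ q t x → (q :+ (con 1 :+ t)) :* (q :* x) :+ t :* x
         := (con 1 :+ q) :* ((q :+ t) :* x)) refl Q t (Q ^ t) ⟩
  suc Q * ((Q + t) * Q ^ t)        ≤⟨ *-monoʳ-≤ (suc Q) (bernoulli Q t) ⟩
  suc Q * (Q * suc Q ^ t)          ≡⟨ solve 3 (λ s q x → s :* (q :* x) := q :* (s :* x))
                                        refl (suc Q) Q (suc Q ^ t) ⟩
  Q * (suc Q * suc Q ^ t)          ∎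
  where
  open ≤-Reasoning
  open +-*-Solver

2*Q^Q≤[1+Q]^Q : ∀ Q .{{_ : NonZero Q}} → 2 * Q ^ Q ≤ suc Q ^ Q
2*Q^Q≤[1+Q]^Q Q = *-cancelˡ-≤ Q (≤-trans
  (≤-reflexive (solve 2 (λ q x → q :* (con 2 :* x) := (q :+ q) :* x) refl Q (Q ^ Q)))
  (bernoulli Q Q))
  where open +-*-Solver

n<2^n : ∀ n → n < 2 ^ n
n<2^n zero    = s≤s z≤n
n<2^n (suc n) = ≤-trans (+-mono-≤ (s≤s z≤n) (n<2^n n))
  (≤-trans (+-monoˡ-≤ (2 ^ n) (m^n>0 2 n)) (≤-reflexive (cong (λ x → 2 ^ n + x) (sym (+-identityʳ (2 ^ n))))))

-- With t = 4^i the power t^k is 2^(2 i k), so only exponents are compared: i ≥ E and i ≥ 2 k give E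
-- + 2 i k ≤ i + i² ≤ (1 + i)² ≤ 4^i = t.
exp-beats-monomial : ∀ E k n₀ → ∃[ t ] n₀ < t × E * t ^ k ≤ 2 ^ t
exp-beats-monomial E k n₀ = t , ≤-trans (s≤s n₀≤i) 1+i≤t , (begin
  E * t ^ k                    ≡⟨ cong (E *_) (^-*-assoc 2 (i + i) k) ⟩
  E * 2 ^ ((i + i) * k)        ≤⟨ *-monoˡ-≤ (2 ^ ((i + i) * k)) (<⇒≤ (n<2^n E)) ⟩
  2 ^ E * 2 ^ ((i + i) * k)    ≡⟨ ^-distribˡ-+-* 2 E ((i + i) * k) ⟨
  2 ^ (E + (i + i) * k)        ≤⟨ ^-monoʳ-≤ 2 exponent≤t ⟩
  2 ^ t                        ∎)
  where
  open ≤-Reasoning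
  open +-*-Solver
  i = E + (2 * k + n₀)
  t = 2 ^ (i + i)
  n₀≤i : n₀ ≤ i
  n₀≤i = ≤-trans (m≤n+m n₀ (2 * k)) (m≤n+m _ E)
  [1+i]²≤t : suc i * suc i ≤ t
  [1+i]²≤t = ≤-trans (*-mono-≤ (n<2^n i) (n<2^n i)) (≤-reflexive (sym (^-distribˡ-+-* 2 i i)))
  1+i≤t : suc i ≤ t
  1+i≤t = ≤-trans (m≤m*n (suc i) (suc i)) [1+i]²≤t
  exponent≤t : E + (i + i) * k ≤ t
  exponent≤t = begin
    E + (i + i) * k            ≡⟨ solve 3 (λ e i k → e :+ (i :+ i) :* k := e :+ i :* (con 2 :* k)) refl E i k ⟩
    E + i * (2 * k)            ≤⟨ +-mono-≤ (m≤m+n E _) (*-monoʳ-≤ i (≤-trans (m≤m+n (2 * k) n₀) (m≤n+m _ E))) ⟩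
    i + i * i                  ≤⟨ +-mono-≤ (n≤1+n i) (*-monoʳ-≤ i (n≤1+n i)) ⟩
    suc i * suc i              ≤⟨ [1+i]²≤t ⟩
    t                          ∎

-- For n = Q t the ratio ((Q + 1) / Q)^n is at least 2^t, which outgrows the polynomial B (Q t)^k.
exp-gap : ∀ Q .{{_ : NonZero Q}} B k n₀ →
  ∃[ n ] NonZero n × n₀ < n × Q ^ n * (B * n ^ k) ≤ suc Q ^ n
exp-gap Q B k n₀ with t , n₀<t , Et^k≤2^t ← exp-beats-monomial (B * Q ^ k) k n₀ =
  Q * t , ℕ.>-nonZero (≤-<-trans z≤n n₀<n) , n₀<n , (begin
    Q ^ (Q * t) * (B * (Q * t) ^ k)
      ≡⟨ cong₂ (λ x y → x * (B * y)) (sym (^-*-assoc Q Q t)) (^-distribʳ-* Q t k) ⟩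
    (Q ^ Q) ^ t * (B * (Q ^ k * t ^ k))
      ≡⟨ cong ((Q ^ Q) ^ t *_) (sym (*-assoc B (Q ^ k) (t ^ k))) ⟩
    (Q ^ Q) ^ t * (B * Q ^ k * t ^ k)
      ≤⟨ *-monoʳ-≤ ((Q ^ Q) ^ t) Et^k≤2^t ⟩
    (Q ^ Q) ^ t * 2 ^ t
      ≡⟨ trans (*-comm ((Q ^ Q) ^ t) (2 ^ t)) (sym (^-distribʳ-* 2 (Q ^ Q) t)) ⟩
    (2 * Q ^ Q) ^ t
      ≤⟨ ^-monoˡ-≤ t (2*Q^Q≤[1+Q]^Q Q) ⟩
    (suc Q ^ Q) ^ t
      ≡⟨ ^-*-assoc (suc Q) Q t ⟩
    suc Q ^ (Q * t) ∎)
  where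
  open ≤-Reasoning
  n₀<n : n₀ < Q * t
  n₀<n = ≤-trans n₀<t (m≤n*m t Q)

^-cancelˡ-< : ∀ q {m n} → m ^ q < n ^ q → m < n
^-cancelˡ-< q m^q<n^q = ≰⇒> λ n≤m → <⇒≱ m^q<n^q (^-monoˡ-≤ q n≤m)

-- Fractions and approximate roots

infix 8 _÷_
_÷_ : ℕ → (d : ℕ) .{{_ : NonZero d}} → ℚ
a ÷ d = (pos a) ℚ./ d

toℚᵘ-÷ : ∀ a d → ℚ.toℚᵘ (a ÷ suc d) ℚᵘ.≃ ℚᵘ.mkℚᵘ (pos a) d
toℚᵘ-÷ a d = ℚ.toℚᵘ-fromℚᵘ (ℚᵘ.mkℚᵘ (pos a) d)

÷-mono-≤ : ∀ {a x b y} → a * suc y ≤ b * suc x → a ÷ suc x ℚ.≤ b ÷ suc y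
÷-mono-≤ {a} {x} {b} {y} le = ℚ.toℚᵘ-cancel-≤
  (ℚᵘ.≤-respˡ-≃ (ℚᵘ.≃-sym (toℚᵘ-÷ a x)) (ℚᵘ.≤-respʳ-≃ (ℚᵘ.≃-sym (toℚᵘ-÷ b y))
    (ℚᵘ.*≤* (subst₂ ℤ._≤_ (ℤ.pos-* a (suc y)) (ℤ.pos-* b (suc x)) (ℤ.+≤+ le)))))

÷-* : ∀ a x b y → a ÷ suc x ℚ.* b ÷ suc y ≡ (a * b) ÷ (suc x * suc y)
÷-* a x b y = ℚ.toℚᵘ-injective (ℚᵘ.≃-trans (ℚ.toℚᵘ-homo-* (a ÷ suc x) (b ÷ suc y))
  (ℚᵘ.≃-trans (ℚᵘ.*-cong (toℚᵘ-÷ a x) (toℚᵘ-÷ b y))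
  (ℚᵘ.≃-trans (ℚᵘ.≃-reflexive (cong (λ i → ℚᵘ.mkℚᵘ i (y + x * suc y)) (sym (ℤ.pos-* a b))))
    (ℚᵘ.≃-sym (toℚᵘ-÷ (a * b) (y + x * suc y))))))

÷-+ : ∀ a x b y → a ÷ suc x ℚ.+ b ÷ suc y ≡ (a * suc y + b * suc x) ÷ (suc x * suc y)
÷-+ a x b y = ℚ.toℚᵘ-injective (ℚᵘ.≃-trans (ℚ.toℚᵘ-homo-+ (a ÷ suc x) (b ÷ suc y))
  (ℚᵘ.≃-trans (ℚᵘ.+-cong (toℚᵘ-÷ a x) (toℚᵘ-÷ b y))
  (ℚᵘ.≃-trans (ℚᵘ.≃-reflexive (cong (λ i → ℚᵘ.mkℚᵘ i (y + x * suc y)) numerator))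
    (ℚᵘ.≃-sym (toℚᵘ-÷ (a * suc y + b * suc x) (y + x * suc y))))))
  where
  numerator : pos a ℤ.* pos (suc y) ℤ.+ pos b ℤ.* pos (suc x) ≡ pos (a * suc y + b * suc x)
  numerator = trans (cong₂ ℤ._+_ (sym (ℤ.pos-* a (suc y))) (sym (ℤ.pos-* b (suc x))))
    (sym (ℤ.pos-+ (a * suc y) (b * suc x)))

÷-pos : ∀ a .{{_ : NonZero a}} d → 0ℚ ℚ.< a ÷ suc d
÷-pos a d = ℚ.positive⁻¹ (a ÷ suc d) {{ℚ.normalize-pos a (suc d)}}

-- The denominator D is kept at least 2 so that D m - 1 is nonzero for every m ≥ 1, as `exp-gap`
-- requires of its base.
archimedean : ∀ ε → 0ℚ ℚ.< ε → ∃[ d ] 2 ÷ suc (suc d) ℚ.≤ ε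
archimedean ε 0<ε with ℚ.positive 0<ε
archimedean (ℚ.mkℚ (pos (suc n)) d c) _ | _ = d + suc d ,
  subst (2 ÷ suc (suc (d + suc d)) ℚ.≤_) (ℚ.fromℚᵘ-toℚᵘ (ℚ.mkℚ (pos (suc n)) d c))
    (÷-mono-≤ {2} {suc (d + suc d)} {suc n} {d} (≤-trans
      (≤-reflexive (solve 1 (λ d → con 2 :* (con 1 :+ d) := con 1 :+ (d :+ (con 1 :+ d))) refl d))
      (≤-trans (n≤1+n (suc (d + suc d))) (m≤n*m (suc (suc (d + suc d))) (suc n)))))
  where open +-*-Solver

-- From s ≤ √n and k / 2 = a / b follows s^k ≤ n^(a/b). The version scaled by `K` yields this for
-- every term of the sequence defining `n ^[ a / b ]`.
n^[a/b]-dominates : ∀ s n a b .{{_ : NonZero b}} k → k * b ≡ 2 * a → s * s ≤ n →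
  ∀ K → s ^ k * K ≤ rootFloor b (n ^ a) K
n^[a/b]-dominates s n a b k kb≡2a s²≤n K = rootFloor-max b (n ^ a) K (begin
  (s ^ k * K) ^ b          ≡⟨ ^-distribʳ-* (s ^ k) K b ⟩
  (s ^ k) ^ b * K ^ b      ≡⟨ cong (_* K ^ b) (trans (^-*-assoc s k b)
                                (trans (cong (s ^_) kb≡2a) (sym (^-*-assoc s 2 a)))) ⟩
  (s ^ 2) ^ a * K ^ b      ≡⟨ cong (λ x → (s * x) ^ a * K ^ b) (*-identityʳ s) ⟩
  (s * s) ^ a * K ^ b      ≤⟨ *-monoˡ-≤ (K ^ b) (^-monoˡ-≤ a s²≤n) ⟩
  n ^ a * K ^ b            ∎)
  where open ≤-Reasoning

recip-cancel : ∀ {p} q → 0ℚ ℚ.< p → recip p ℚ.* (p ℚ.* q) ≡ q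
recip-cancel {p} q 0<p = trans (sym (ℚ.*-assoc (recip p) p q))
  (trans (cong (ℚ._* q) (recip-inverse (λ p≡0 → ℚ.<-irrefl (sym p≡0) 0<p))) (ℚ.*-identityˡ q))

-- For D = `suc d` the hypothesis says that the n-th root of C is at least Q / D = m - 1/D. The
-- second 1/D absorbs the rounding error of the j-th approximation, which is below 1 / (j + 1) ≤
-- 1/D.
root-≥ : ∀ n .{{_ : NonZero n}} m d C {Q} → suc d * m ≡ suc Q →
  Q ^ n ≤ C * suc d ^ n →
  ∀ j → d ≤ j → m ÷ 1 ℚ.≤ seq (root n C) j ℚ.+ 2 ÷ suc d
root-≥ n m d C {Q} Dm≡1+Q Q^n≤ j d≤j = subst (m ÷ 1 ℚ.≤_) (sym (÷-+ r j 2 d))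
  (÷-mono-≤ {m} {0} {r * suc d + 2 * suc j} {d + j * suc d} (begin
    m * (suc j * suc d)            ≡⟨ solve 3 (λ m K D → m :* (K :* D) := D :* m :* K) refl m (suc j) (suc d) ⟩
    suc d * m * suc j              ≡⟨ cong (_* suc j) Dm≡1+Q ⟩
    suc j + Q * suc j              ≤⟨ +-monoʳ-≤ (suc j) (<⇒≤ QK<D[1+r]) ⟩
    suc j + suc d * suc r          ≡⟨ solve 3 (λ K D r → K :+ D :* (con 1 :+ r) := r :* D :+ (D :+ K))
                                        refl (suc j) (suc d) r ⟩
    r * suc d + (suc d + suc j)    ≤⟨ +-monoʳ-≤ (r * suc d) (+-monoˡ-≤ (suc j) (s≤s d≤j)) ⟩
    r * suc d + (suc j + suc j)    ≡⟨ solve 2 (λ x K → x :+ (K :+ K) := (x :+ con 2 :* K) :* con 1)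
                                        refl (r * suc d) (suc j) ⟩
    (r * suc d + 2 * suc j) * 1    ∎))
  where
  open ≤-Reasoning
  open +-*-Solver
  r = rootFloor n C (suc j)
  QK<D[1+r] : Q * suc j < suc d * suc r
  QK<D[1+r] = ^-cancelˡ-< n (begin-strict
    (Q * suc j) ^ n            ≡⟨ ^-distribʳ-* Q (suc j) n ⟩
    Q ^ n * suc j ^ n          ≤⟨ *-monoˡ-≤ (suc j ^ n) Q^n≤ ⟩
    C * suc d ^ n * suc j ^ n  ≡⟨ solve 3 (λ c D K → c :* D :* K := D :* (c :* K)) refl
                                    C (suc d ^ n) (suc j ^ n) ⟩
    suc d ^ n * (C * suc j ^ n)
      <⟨ *-monoʳ-< (suc d ^ n) {{m^n≢0 (suc d) n}} (rootFloor-upper n C (suc j)) ⟩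
    suc d ^ n * suc r ^ n      ≡⟨ ^-distribʳ-* (suc d) (suc r) n ⟨
    (suc d * suc r) ^ n        ∎)

half-pos : ∀ {ε} → 0ℚ ℚ.< ε → 0ℚ ℚ.< ½ ℚ.* ε
half-pos {ε} 0<ε = subst (ℚ._< ½ ℚ.* ε) (ℚ.*-zeroʳ ½) (ℚ.*-monoʳ-<-pos ½ 0<ε)

halves : ∀ ε → ½ ℚ.* ε ℚ.+ ½ ℚ.* ε ≡ ε
halves ε = trans (sym (ℚ.*-distribʳ-+ ε ½ ½)) (ℚ.*-identityˡ ε)

p≤∣p∣ : ∀ p → p ℚ.≤ ℚ.∣ p ∣
p≤∣p∣ p with ℚ.≤-total 0ℚ p
... | inj₁ 0≤p = ℚ.≤-reflexive (sym (ℚ.0≤p⇒∣p∣≡p 0≤p))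
... | inj₂ p≤0 = ℚ.≤-trans p≤0 (ℚ.0≤∣p∣ p)

-- Asymptotic consequences of the finite bound

module _ {p m : ℕ} .{{_ : NonZero p}} (B k : ℕ) .{{_ : NonZero B}}
  (large : ∀ n .{{_ : NonZero n}} → m ^ n ≤ B * ⌊√ n ⌋ ^ k * maxCapSize n p) where

  -- The constant is 1/B. The inequality holds for each rational approximation of n^(a/b)
  -- separately, so `ε` is pure slack.
  capSizes-≫ : ∀ a b .{{_ : NonZero b}} → k * b ≡ 2 * a → capSizes p ≫ m ^n/n^[ a / b ]
  capSizes-≫ a b kb≡2a = fromℚ (recip β)
    , (recip β , recip-pos 0<β , 0 , λ _ _ → ℚ.≤-reflexive (ℚ.+-identityˡ (recip β)))
    , 0 , λ n _ ε 0<ε → 0 , λ j _ → bound n j ε 0<ε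
    where
    β : ℚ
    β = B ÷ 1
    0<β : 0ℚ ℚ.< β
    0<β = ÷-pos B 0

    bound : ∀ n .{{_ : NonZero n}} j ε → 0ℚ ℚ.< ε →
      recip β ℚ.* ((m ^ n) ÷ 1 ℚ.* recip (seq (n ^[ a / b ]) j)) ℚ.≤ maxCapSize n p ÷ 1 ℚ.+ ε
    bound n j ε 0<ε = begin
      recip β ℚ.* ((m ^ n) ÷ 1 ℚ.* recip ρ)
        ≤⟨ ℚ.*-monoˡ-≤-nonNeg (recip β) {{nonNeg (recip-pos 0<β)}}
             (ℚ.*-monoʳ-≤-nonNeg (recip ρ) {{nonNeg (recip-pos 0<ρ)}} m^n≤βCρ) ⟩
      recip β ℚ.* (β ℚ.* (C ÷ 1 ℚ.* ρ) ℚ.* recip ρ)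
        ≡⟨ cong (recip β ℚ.*_) (ℚ.*-assoc β (C ÷ 1 ℚ.* ρ) (recip ρ)) ⟩
      recip β ℚ.* (β ℚ.* (C ÷ 1 ℚ.* ρ ℚ.* recip ρ))
        ≡⟨ recip-cancel _ 0<β ⟩
      C ÷ 1 ℚ.* ρ ℚ.* recip ρ
        ≡⟨ trans (cong (ℚ._* recip ρ) (ℚ.*-comm (C ÷ 1) ρ)) (ℚ.*-comm (ρ ℚ.* C ÷ 1) (recip ρ)) ⟩
      recip ρ ℚ.* (ρ ℚ.* C ÷ 1)
        ≡⟨ recip-cancel (C ÷ 1) 0<ρ ⟩
      C ÷ 1
        ≡⟨ ℚ.+-identityʳ (C ÷ 1) ⟨
      C ÷ 1 ℚ.+ 0ℚ
        ≤⟨ ℚ.+-monoʳ-≤ (C ÷ 1) (ℚ.<⇒≤ 0<ε) ⟩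
      C ÷ 1 ℚ.+ ε ∎
      where
      open ℚ.≤-Reasoning
      nonNeg : ∀ {q} → 0ℚ ℚ.< q → ℚ.NonNegative q
      nonNeg 0<q = ℚ.nonNegative (ℚ.<⇒≤ 0<q)
      C = maxCapSize n p
      r = rootFloor b (n ^ a) (suc j)
      ρ : ℚ
      ρ = r ÷ suc j
      -- Every approximation of n^(a/b) is at least 1, so `recip` never takes its default value.
      0<ρ : 0ℚ ℚ.< ρ
      0<ρ = ℚ.<-≤-trans (ℚ.positive⁻¹ ℚ.1ℚ)
        (subst (ℚ._≤ ρ) (ℚ.+-identityˡ ℚ.1ℚ) (proj₂ (proj₂ (proj₂ (^[/]-pos n a b))) j z≤n))
      m^nK≤BCr : m ^ n * suc j ≤ B * (C * r)
      m^nK≤BCr = ≤-trans (*-monoˡ-≤ (suc j) (large n))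
        (≤-trans (≤-reflexive (solve 4 (λ B x c K → B :* x :* c :* K := B :* (c :* (x :* K)))
                   refl B (⌊√ n ⌋ ^ k) C (suc j)))
          (*-monoʳ-≤ B (*-monoʳ-≤ C (n^[a/b]-dominates ⌊√ n ⌋ n a b k kb≡2a (⌊√n⌋²≤n n) (suc j)))))
        where open +-*-Solver
      m^n≤βCρ : (m ^ n) ÷ 1 ℚ.≤ β ℚ.* (C ÷ 1 ℚ.* ρ)
      m^n≤βCρ = subst ((m ^ n) ÷ 1 ℚ.≤_) (sym (trans
          (cong (β ℚ.*_) (÷-* C 0 r j)) (÷-* B 0 (C * r) (j + 0))))
        (÷-mono-≤ {m ^ n} {0} {B * (C * r)} {j + 0 + 0} (subst₂ _≤_
          (cong (λ K → m ^ n * suc K) (trans (sym (+-identityʳ j)) (sym (+-identityʳ (j + 0)))))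
          (sym (*-identityʳ (B * (C * r)))) m^nK≤BCr))

  -- Q / D = m - 1/D lies just below m, and `exp-gap` finds an n at which (D m / Q)^n exceeds the
  -- polynomial loss. The crude bound `⌊√ n ⌋` ≤ n is enough for this.
  near-root : .{{_ : NonZero m}} → ∀ d n₀ → ∃[ Q ] suc (suc d) * m ≡ suc Q ×
    (∃[ n ] Σ[ n≢0 ∈ NonZero n ] n₀ < n × Q ^ n ≤ maxCapSize n p * suc (suc d) ^ n)
  near-root d n₀ =
    let n , n≢0 , n₀<n , gap = exp-gap Q {{Q≢0}} B k n₀ in
    Q , Dm≡1+Q , n , n≢0 , n₀<n , *-cancelʳ-≤ _ _ (B * n ^ k) {{Bn^k≢0 n {{n≢0}}}} (begin
      Q ^ n * (B * n ^ k)          ≤⟨ gap ⟩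
      suc Q ^ n                    ≡⟨ cong (_^ n) Dm≡1+Q ⟨
      (D * m) ^ n                  ≡⟨ ^-distribʳ-* D m n ⟩
      D ^ n * m ^ n                ≤⟨ *-monoʳ-≤ (D ^ n) (large n {{n≢0}}) ⟩
      D ^ n * (B * ⌊√ n ⌋ ^ k * maxCapSize n p)
        ≤⟨ *-monoʳ-≤ (D ^ n) (*-monoˡ-≤ (maxCapSize n p) (*-monoʳ-≤ B (^-monoˡ-≤ k
             (≤-trans (n≤n*n ⌊√ n ⌋) (⌊√n⌋²≤n n))))) ⟩
      D ^ n * (B * n ^ k * maxCapSize n p)
        ≡⟨ solve 3 (λ x y z → x :* (y :* z) := z :* x :* y) refl (D ^ n) (B * n ^ k) (maxCapSize n p) ⟩
      maxCapSize n p * D ^ n * (B * n ^ k) ∎)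
    where
    open ≤-Reasoning
    open +-*-Solver
    D = suc (suc d)
    Q = pred (D * m)
    2≤Dm : 2 ≤ D * m
    2≤Dm = ≤-trans (s≤s (s≤s z≤n)) (m≤m*n D m)
    Dm≡1+Q : D * m ≡ suc Q
    Dm≡1+Q = sym (suc-pred (D * m) {{ℕ.>-nonZero (<⇒≤ 2≤Dm)}})
    Q≢0 : NonZero Q
    Q≢0 = ℕ.>-nonZero (pred-mono-≤ 2≤Dm)
    Bn^k≢0 : ∀ n .{{_ : NonZero n}} → NonZero (B * n ^ k)
    Bn^k≢0 n = m*n≢0 B (n ^ k) {{it}} {{m^n≢0 n k}}

  capSizeRoots-limit : .{{_ : NonZero m}} → ∀ c → capSizeRoots p ⟶ c → fromℕ m ≤ᵣ c
  capSizeRoots-limit c conv ε 0<ε =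
    -- Half of ε pays for 2/D, a quarter for the distance of the n-th root from c, and a quarter for
    -- the tolerance inside `_≤ᵣ_`.
    let η = ½ ℚ.* (½ ℚ.* ε)
        0<η = half-pos (half-pos 0<ε)
        d , 2/D≤ = archimedean (½ ℚ.* ε) (half-pos 0<ε)
        n₀ , close = conv (fromℚ η) (η , 0<η , 0 , λ _ _ → ℚ.≤-reflexive (ℚ.+-identityˡ η))
        Q , Dm≡1+Q , n , n≢0 , n₀<n , Q^n≤ = near-root d n₀
        N , near = close n {{n≢0}} n₀<n η 0<η
    in N ⊔ suc d , λ j N⊔D≤j →
      let ρ = seq (root n {{n≢0}} (maxCapSize n p)) j
      in begin
        m ÷ 1
          ≤⟨ root-≥ n {{n≢0}} m (suc d) (maxCapSize n p) Dm≡1+Q Q^n≤ j (m⊔n≤o⇒n≤o N (suc d) N⊔D≤j) ⟩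
        ρ ℚ.+ 2 ÷ suc (suc d)
          ≤⟨ ℚ.+-monoʳ-≤ ρ 2/D≤ ⟩
        ρ ℚ.+ ½ ℚ.* ε
          ≡⟨ cong (ℚ._+ ½ ℚ.* ε) (add-sub (seq c j) ρ) ⟨
        seq c j ℚ.+ (ρ ℚ.- seq c j) ℚ.+ ½ ℚ.* ε
          ≤⟨ ℚ.+-monoˡ-≤ (½ ℚ.* ε) (ℚ.+-monoʳ-≤ (seq c j)
               (ℚ.≤-trans (p≤∣p∣ (ρ ℚ.- seq c j)) (near j (m⊔n≤o⇒m≤o N (suc d) N⊔D≤j)))) ⟩
        seq c j ℚ.+ (½ ℚ.* (½ ℚ.* ε) ℚ.+ ½ ℚ.* (½ ℚ.* ε)) ℚ.+ ½ ℚ.* ε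
          ≡⟨ cong (λ x → seq c j ℚ.+ x ℚ.+ ½ ℚ.* ε) (halves (½ ℚ.* ε)) ⟩
        seq c j ℚ.+ ½ ℚ.* ε ℚ.+ ½ ℚ.* ε
          ≡⟨ trans (ℚ.+-assoc (seq c j) _ _) (cong (seq c j ℚ.+_) (halves ε)) ⟩
        seq c j ℚ.+ ε ∎
    where
    open ℚ.≤-Reasoning
    open ℚ-Solver
    add-sub : ∀ c r → c ℚ.+ (r ℚ.- c) ≡ r
    add-sub = solve 2 (λ c r → c :+ (r :- c) := r) refl

-- The digits were found by computer search; the weights are integral solutions
-- of the linear programs dual to the existence of a nontrivial balanced family
-- of lines.

design11 : Design 11 3
design11 = record
  { digits  = 0 ∷ 1 ∷ 2 ∷ 3 ∷ 4 ∷ []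
  -- All five primes are 2 modulo 3, so the p - 2 ratios other than 0 and -1 form one orbit of
  -- three, the midpoint ratios 1, -2 and -1/2, and (p - 5)/6 orbits of six. Each design lists (p +
  -- 1)/6 triples, as many as there are orbits.
  ; weights =
      -- The midpoint orbit: f d = h d = d (d - 1)/2 takes the same value at 0 and 1, and g = 12 - 2
      -- f. Separation reads f x + f z > 2 f y for y midway between x and z, which is strict
      -- convexity.
      ( 0 ∷ 1 ∷ 3 ∷ 6 ∷ []
      , 12 ∷ 10 ∷ 6 ∷ 0 ∷ []
      , 0 ∷ 1 ∷ 3 ∷ 6 ∷ [] )
    ∷
      ( 1 ∷ 0 ∷ 0 ∷ 2 ∷ []
      , 0 ∷ 3 ∷ 0 ∷ 1 ∷ []
      , 2 ∷ 0 ∷ 3 ∷ 0 ∷ [] )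
    ∷ []
  }

design17 : Design 17 5
design17 = record
  { digits  = 0 ∷ 1 ∷ 2 ∷ 3 ∷ 4 ∷ 11 ∷ 15 ∷ []
  ; weights =
      ( 0 ∷ 1 ∷ 3 ∷ 6 ∷ 3 ∷ 0 ∷ []
      , 12 ∷ 10 ∷ 6 ∷ 0 ∷ 9 ∷ 12 ∷ []
      , 0 ∷ 1 ∷ 3 ∷ 6 ∷ 0 ∷ 0 ∷ [] )
    ∷
      ( 3 ∷ 0 ∷ 0 ∷ 4 ∷ 2 ∷ 4 ∷ []
      , 3 ∷ 7 ∷ 3 ∷ 0 ∷ 0 ∷ 0 ∷ []
      , 1 ∷ 0 ∷ 4 ∷ 3 ∷ 5 ∷ 3 ∷ [] )
    ∷
      ( 3 ∷ 0 ∷ 0 ∷ 4 ∷ 0 ∷ 3 ∷ []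
      , 0 ∷ 4 ∷ 1 ∷ 0 ∷ 2 ∷ 0 ∷ []
      , 1 ∷ 0 ∷ 3 ∷ 0 ∷ 2 ∷ 1 ∷ [] )
    ∷ []
  }

design23 : Design 23 7
design23 = record
  { digits  = 0 ∷ 1 ∷ 2 ∷ 3 ∷ 4 ∷ 5 ∷ 12 ∷ 16 ∷ 20 ∷ []
  ; weights =
      ( 1 ∷ 2 ∷ 4 ∷ 7 ∷ 11 ∷ 1 ∷ 0 ∷ 0 ∷ []
      , 2 ∷ 3 ∷ 5 ∷ 8 ∷ 12 ∷ 1 ∷ 0 ∷ 0 ∷ []
      , 20 ∷ 18 ∷ 14 ∷ 8 ∷ 0 ∷ 21 ∷ 23 ∷ 23 ∷ [] )
    ∷
      ( 6 ∷ 0 ∷ 2 ∷ 4 ∷ 8 ∷ 6 ∷ 6 ∷ 1 ∷ []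
      , 6 ∷ 11 ∷ 9 ∷ 6 ∷ 0 ∷ 5 ∷ 7 ∷ 6 ∷ []
      , 1 ∷ 2 ∷ 2 ∷ 3 ∷ 5 ∷ 2 ∷ 0 ∷ 6 ∷ [] )
    ∷
      ( 33 ∷ 16 ∷ 0 ∷ 31 ∷ 37 ∷ 7 ∷ 7 ∷ 10 ∷ []
      , 15 ∷ 5 ∷ 18 ∷ 12 ∷ 0 ∷ 42 ∷ 34 ∷ 22 ∷ []
      , 1 ∷ 28 ∷ 31 ∷ 6 ∷ 12 ∷ 0 ∷ 8 ∷ 17 ∷ [] )
    ∷
      ( 0 ∷ 22 ∷ 6 ∷ 10 ∷ 1 ∷ 12 ∷ 8 ∷ 0 ∷ []
      , 11 ∷ 21 ∷ 4 ∷ 0 ∷ 11 ∷ 13 ∷ 11 ∷ 20 ∷ []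
      , 32 ∷ 0 ∷ 33 ∷ 33 ∷ 31 ∷ 18 ∷ 24 ∷ 23 ∷ [] )
    ∷ []
  }

design29 : Design 29 8
design29 = record
  { digits  = 0 ∷ 1 ∷ 2 ∷ 6 ∷ 9 ∷ 10 ∷ 12 ∷ 17 ∷ 24 ∷ 27 ∷ []
  ; weights =
      ( 0 ∷ 1 ∷ 0 ∷ 2 ∷ 19 ∷ 2 ∷ 12 ∷ 6 ∷ 2 ∷ []
      , 38 ∷ 36 ∷ 37 ∷ 36 ∷ 0 ∷ 33 ∷ 14 ∷ 26 ∷ 33 ∷ []
      , 0 ∷ 1 ∷ 1 ∷ 0 ∷ 19 ∷ 3 ∷ 12 ∷ 6 ∷ 3 ∷ [] )
    ∷
      ( 4 ∷ 3 ∷ 7 ∷ 12 ∷ 3 ∷ 0 ∷ 8 ∷ 5 ∷ 11 ∷ []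
      , 18 ∷ 15 ∷ 11 ∷ 8 ∷ 19 ∷ 20 ∷ 16 ∷ 20 ∷ 0 ∷ []
      , 3 ∷ 7 ∷ 7 ∷ 5 ∷ 3 ∷ 5 ∷ 1 ∷ 0 ∷ 14 ∷ [] )
    ∷
      ( 2 ∷ 6 ∷ 0 ∷ 6 ∷ 5 ∷ 4 ∷ 1 ∷ 0 ∷ 6 ∷ []
      , 1 ∷ 0 ∷ 6 ∷ 2 ∷ 0 ∷ 4 ∷ 4 ∷ 7 ∷ 0 ∷ []
      , 5 ∷ 2 ∷ 2 ∷ 0 ∷ 3 ∷ 0 ∷ 3 ∷ 1 ∷ 2 ∷ [] )
    ∷
      ( 20 ∷ 0 ∷ 13 ∷ 17 ∷ 0 ∷ 20 ∷ 17 ∷ 9 ∷ 15 ∷ []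
      , 0 ∷ 8 ∷ 6 ∷ 5 ∷ 11 ∷ 3 ∷ 0 ∷ 8 ∷ 4 ∷ []
      , 3 ∷ 15 ∷ 4 ∷ 1 ∷ 12 ∷ 0 ∷ 6 ∷ 6 ∷ 4 ∷ [] )
    ∷
      ( 7 ∷ 6 ∷ 0 ∷ 8 ∷ 6 ∷ 5 ∷ 3 ∷ 9 ∷ 5 ∷ []
      , 1 ∷ 3 ∷ 6 ∷ 1 ∷ 1 ∷ 1 ∷ 2 ∷ 0 ∷ 1 ∷ []
      , 1 ∷ 0 ∷ 3 ∷ 0 ∷ 2 ∷ 3 ∷ 4 ∷ 0 ∷ 3 ∷ [] )
    ∷ []
  }

design41 : Design 41 10
design41 = record
  { digits  = 0 ∷ 1 ∷ 2 ∷ 5 ∷ 6 ∷ 15 ∷ 16 ∷ 20 ∷ 23 ∷ 27 ∷ 32 ∷ 40 ∷ []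
  ; weights =
      ( 0 ∷ 1 ∷ 7 ∷ 8 ∷ 2 ∷ 0 ∷ 0 ∷ 3 ∷ 1 ∷ 1 ∷ 1 ∷ []
      , 14 ∷ 7 ∷ 0 ∷ 0 ∷ 1 ∷ 14 ∷ 14 ∷ 8 ∷ 0 ∷ 12 ∷ 12 ∷ []
      , 0 ∷ 6 ∷ 7 ∷ 6 ∷ 11 ∷ 0 ∷ 0 ∷ 3 ∷ 13 ∷ 1 ∷ 1 ∷ [] )
    ∷
      ( 15 ∷ 16 ∷ 3 ∷ 11 ∷ 0 ∷ 17 ∷ 18 ∷ 17 ∷ 17 ∷ 3 ∷ 16 ∷ []
      , 1 ∷ 0 ∷ 0 ∷ 3 ∷ 2 ∷ 0 ∷ 0 ∷ 7 ∷ 2 ∷ 8 ∷ 0 ∷ []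
      , 8 ∷ 8 ∷ 21 ∷ 10 ∷ 22 ∷ 7 ∷ 6 ∷ 0 ∷ 5 ∷ 13 ∷ 8 ∷ [] )
    ∷
      ( 7 ∷ 8 ∷ 0 ∷ 9 ∷ 8 ∷ 12 ∷ 7 ∷ 1 ∷ 8 ∷ 9 ∷ 9 ∷ []
      , 2 ∷ 2 ∷ 8 ∷ 2 ∷ 13 ∷ 3 ∷ 2 ∷ 7 ∷ 2 ∷ 4 ∷ 0 ∷ []
      , 12 ∷ 11 ∷ 13 ∷ 10 ∷ 0 ∷ 6 ∷ 12 ∷ 13 ∷ 11 ∷ 8 ∷ 12 ∷ [] )
    ∷
      ( 3 ∷ 5 ∷ 4 ∷ 5 ∷ 6 ∷ 7 ∷ 3 ∷ 5 ∷ 4 ∷ 3 ∷ 0 ∷ []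
      , 1 ∷ 0 ∷ 0 ∷ 2 ∷ 9 ∷ 0 ∷ 5 ∷ 5 ∷ 5 ∷ 2 ∷ 3 ∷ []
      , 11 ∷ 10 ∷ 11 ∷ 8 ∷ 0 ∷ 8 ∷ 7 ∷ 5 ∷ 6 ∷ 10 ∷ 12 ∷ [] )
    ∷
      ( 17 ∷ 13 ∷ 19 ∷ 11 ∷ 8 ∷ 0 ∷ 11 ∷ 17 ∷ 17 ∷ 18 ∷ 10 ∷ []
      , 8 ∷ 18 ∷ 15 ∷ 9 ∷ 9 ∷ 18 ∷ 13 ∷ 8 ∷ 0 ∷ 0 ∷ 8 ∷ []
      , 9 ∷ 3 ∷ 0 ∷ 14 ∷ 17 ∷ 16 ∷ 10 ∷ 9 ∷ 17 ∷ 16 ∷ 16 ∷ [] )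
    ∷
      ( 3 ∷ 3 ∷ 10 ∷ 4 ∷ 8 ∷ 5 ∷ 10 ∷ 14 ∷ 12 ∷ 0 ∷ 8 ∷ []
      , 4 ∷ 10 ∷ 13 ∷ 9 ∷ 0 ∷ 6 ∷ 9 ∷ 0 ∷ 5 ∷ 11 ∷ 12 ∷ []
      , 16 ∷ 10 ∷ 0 ∷ 10 ∷ 15 ∷ 12 ∷ 4 ∷ 9 ∷ 6 ∷ 12 ∷ 3 ∷ [] )
    ∷
      ( 4 ∷ 8 ∷ 4 ∷ 5 ∷ 0 ∷ 1 ∷ 8 ∷ 0 ∷ 4 ∷ 4 ∷ 4 ∷ []
      , 0 ∷ 0 ∷ 0 ∷ 1 ∷ 5 ∷ 6 ∷ 5 ∷ 4 ∷ 1 ∷ 3 ∷ 4 ∷ []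
      , 9 ∷ 5 ∷ 9 ∷ 7 ∷ 8 ∷ 6 ∷ 0 ∷ 9 ∷ 8 ∷ 6 ∷ 5 ∷ [] )
    ∷ []
  }

-- Verification of the designs by evaluation

valid11 : IsValid design11
valid11 = toWitness {a? = isValid? design11} tt

valid17 : IsValid design17
valid17 = toWitness {a? = isValid? design17} tt

valid23 : IsValid design23
valid23 = toWitness {a? = isValid? design23} tt

valid29 : IsValid design29
valid29 = toWitness {a? = isValid? design29} tt

valid41 : IsValid design41
valid41 = toWitness {a? = isValid? design41} tt

module Bounds {p k : ℕ} .{{_ : NonZero p}} (D : Design p k) (valid : IsValid D) where

  private instance
    _ = lossFactor≢0 k

  growth : ∀ a b .{{_ : NonZero b}} → k * b ≡ 2 * a → capSizes p ≫ (2 + k) ^n/n^[ a / b ]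
  growth = capSizes-≫ (lossFactor k) k (m^n≤maxCapSize D valid)

  limit : ∀ c → capSizeRoots p ⟶ c → fromℕ (2 + k) ≤ᵣ c
  limit = capSizeRoots-limit (lossFactor k) k (m^n≤maxCapSize D valid)

theorem1 :
    ( capSizes 11 ≫ 5 ^n/n^[ 3 / 2 ]
    × capSizes 17 ≫ 7 ^n/n^[ 5 / 2 ]
    × capSizes 23 ≫ 9 ^n/n^[ 7 / 2 ]
    × capSizes 29 ≫ 10 ^n/n^[ 4 / 1 ]
    × capSizes 41 ≫ 12 ^n/n^[ 5 / 1 ] )
    ×
    ( (∀ c → capSizeRoots 11 ⟶ c → fromℕ 5 ≤ᵣ c)
    × (∀ c → capSizeRoots 17 ⟶ c → fromℕ 7 ≤ᵣ c)
    × (∀ c → capSizeRoots 23 ⟶ c → fromℕ 9 ≤ᵣ c)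
    × (∀ c → capSizeRoots 29 ⟶ c → fromℕ 10 ≤ᵣ c)
    × (∀ c → capSizeRoots 41 ⟶ c → fromℕ 12 ≤ᵣ c) )
theorem1 =
    ( growth design11 valid11 3 2 refl
    , growth design17 valid17 5 2 refl
    , growth design23 valid23 7 2 refl
    , growth design29 valid29 4 1 refl
    , growth design41 valid41 5 1 refl )
  , ( limit design11 valid11
    , limit design17 valid17
    , limit design23 valid23
    , limit design29 valid29
    , limit design41 valid41 )
  where open Bounds
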